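{- Let $p$ be a prime number and let $q_1<q_2<q_3$ be primes such that $q_1q_2q_3$ is coprime to $p(p-1)$. (a) Let $f(x)=x^{q_1q_2}\prod_{i=1}^{q_1}(x+p^i)^{q_1q_3}(x+p^{q_1+1})^{q_2q_3}\in\mathbb{Z}[x]$. Then $R(f)$ is dense in $\mathbb{Q}_p$; and for all but finitely many primes $q$, in particular for every prime $q>p^{q_1+1}$, $R(f)$ is not dense in $\mathbb{Q}_q$. (b) Let $$g_2(x_1,x_2)=x_1^{q_1q_2}\prod_{i=1}^{q_1}(x_1+p^ix_2)^{q_1q_3}(x_1+p^{q_1+1}x_2)^{q_2q_3}\prod_{i=1}^{q_3-1}(p^ix_1+x_2)^{q_1q_2}\prod_{i=q_3}^{q_3+q_2-q_1-1}(p^ix_1+x_2)^{q_1q_3}\prod_{i=q_3+q_2-q_1}^{q_3+q_2-2}(p^ix_1+x_2)^{q_2q_3}.$$ Then $R(g_2)$ is dense in $\mathbb{Q}_p$; and for all but finitely many primes $q$, in particular for every prime $q>p^{q_3+q_2+q_1-1}$, $R(g_2)$ is not dense in $\mathbb{Q}_q$. (c) Let $n>2$ be an integer and $g_n(x_1,\ldots,x_n)=g_2(x_1,x_2)(x_3\cdots x_n)^{q_1q_2q_3}$. Then $R(g_n)$ is dense in $\mathbb{Q}_p$; and for all but finitely many primes $q$, in particular for every prime $q>p^{q_3+q_2+q_1-1}$, $R(g_n)$ is not dense in $\mathbb{Q}_q$.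
   Context: For a polynomial $h\in\mathbb{Z}[x_1,\dots,x_r]$, $R(h)=\{h(\overline{x})/h(\overline{y}) : \overline{x},\overline{y}\in\mathbb{Z}^r,\ h(\overline{y})\neq 0\}$, and density is in the $p$-adic (resp. $q$-adic) topology. -}

module Defs where

open import Data.Fin.Base using (zero; suc)
open import Data.Integer.Base as ℤ using (ℤ; +_; 0ℤ; 1ℤ)
open import Data.Integer.Solver using (module +-*-Solver)
open import Data.List.Base using (List; foldr; applyUpTo; tabulate)
open import Data.List.Membership.Propositional using (_∉_)
open import Data.Nat.Base using (ℕ; zero; suc; _+_; _*_; _∸_; _^_; _≤_; _<_; s≤s)
open import Data.Nat.Divisibility using (_∤_)
open import Data.Nat.Primality using (Prime)
open import Data.Product.Base using (Σ; ∃; _×_)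
open import Data.Rational.Base as ℚ using (ℚ)
open import Data.Rational.Literals using (fromℤ)
open import Data.Vec.Base using (Vec)
open import Level using (0ℓ)
open import Relation.Binary.PropositionalEquality using (_≡_; _≢_)
open import Relation.Nullary.Negation using (¬_)
open import Relation.Unary using (Pred)

-- Elements of ℤ[x₁,…,xₙ] are given by polynomial expressions with integer
-- coefficients in n variables; var zero is x₁.
open +-*-Solver public using (Polynomial; con; var; _:+_; _:*_; _:^_; ⟦_⟧)

-- The set R(h) of ratios of values of h.
R : ∀ {r} → Polynomial r → Pred ℚ 0ℓ
R {r} h a =
  Σ (Vec ℤ r) λ x → Σ (Vec ℤ r) λ y → Σ (⟦ h ⟧ y ≢ 0ℤ) λ hy≢0 →
    a ≡ ℚ._÷_ (fromℤ (⟦ h ⟧ x)) (fromℤ (⟦ h ⟧ y)) {{ℤ.≢-nonZero hy≢0}}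

-- |a - b|_p ≤ p⁻ᵏ, that is, a - b = pᵏ u / w with u, w integers and p ∤ w.
-- The radii p⁻ᵏ with k ∈ ℕ suffice to describe the p-adic topology.
Within : (p k : ℕ) → ℚ → ℚ → Set
Within p k a b =
  Σ ℤ λ u → Σ ℕ λ w →
    p ∤ w × (a ℚ.- b) ℚ.* fromℤ (+ w) ≡ fromℤ (+ (p ^ k) ℤ.* u)

-- ℚ_p as the completion of ℚ for the p-adic absolute value.  Elements are
-- represented by p-adic Cauchy sequences; two sequences represent the same
-- p-adic number when their difference tends to 0.
record ℚ[_] (p : ℕ) : Set where
  field
    seq    : ℕ → ℚ
    cauchy : ∀ k → ∃ λ N → ∀ m n → N ≤ m → N ≤ n → Within p k (seq m) (seq n)

open ℚ[_] public

-- |x - a|_p ≤ p⁻ᵏ for x ∈ ℚ_p and a ∈ ℚ.  As |·|_p takes discrete values away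
-- from 0, this says that the inequality holds eventually along the sequence;
-- it does not depend on the sequence representing x.
Near : (p k : ℕ) → ℚ[ p ] → ℚ → Set
Near p k x a = ∃ λ N → ∀ n → N ≤ n → Within p k (seq x n) a

DenseIn : (p : ℕ) → Pred ℚ 0ℓ → Set
DenseIn p S = ∀ (x : ℚ[ p ]) (k : ℕ) → ∃ λ a → S a × Near p k x a

-- "For all but finitely many primes q, S is not dense in ℚ_q."
NotDenseForAlmostAllPrimes : Pred ℚ 0ℓ → Set
NotDenseForAlmostAllPrimes S =
  ∃ λ (exceptions : List ℕ) → ∀ q → Prime q → q ∉ exceptions → ¬ DenseIn q S

-- The product of F i over a ≤ i ≤ b.
∏[_⋯_] : ∀ {n} → ℕ → ℕ → (ℕ → Polynomial n) → Polynomial n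
∏[ a ⋯ b ] F = foldr _:*_ (con 1ℤ) (applyUpTo (λ j → F (a + j)) (suc b ∸ a))

module _ (p q₁ q₂ q₃ : ℕ) where

  private
    P : ∀ {n} → ℕ → Polynomial n
    P i = con (+ (p ^ i))

  f : Polynomial 1
  f = x :^ (q₁ * q₂)
      :* ∏[ 1 ⋯ q₁ ] (λ i → (x :+ P i) :^ (q₁ * q₃))
      :* (x :+ P (q₁ + 1)) :^ (q₂ * q₃)
    where
    x : Polynomial 1
    x = var zero

  -- g₂ evaluated at two elements of ℤ[x₁,…,xₙ].
  g₂⟨_,_⟩ : ∀ {n} → Polynomial n → Polynomial n → Polynomial n
  g₂⟨ x₁ , x₂ ⟩ =
      x₁ :^ (q₁ * q₂)
      :* ∏[ 1 ⋯ q₁ ] (λ i → (x₁ :+ P i :* x₂) :^ (q₁ * q₃))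
      :* (x₁ :+ P (q₁ + 1) :* x₂) :^ (q₂ * q₃)
      :* ∏[ 1 ⋯ q₃ ∸ 1 ] (λ i → (P i :* x₁ :+ x₂) :^ (q₁ * q₂))
      :* ∏[ q₃ ⋯ q₃ + q₂ ∸ q₁ ∸ 1 ] (λ i → (P i :* x₁ :+ x₂) :^ (q₁ * q₃))
      :* ∏[ q₃ + q₂ ∸ q₁ ⋯ q₃ + q₂ ∸ 2 ] (λ i → (P i :* x₁ :+ x₂) :^ (q₂ * q₃))

  g₂ : Polynomial 2
  g₂ = g₂⟨ var zero , var (suc zero) ⟩

  g : (n : ℕ) → 2 < n → Polynomial n
  g (suc (suc m)) _ =
      g₂⟨ var zero , var (suc zero) ⟩
      :* foldr _:*_ (con 1ℤ) (tabulate {n = m} (λ j → var (suc (suc j))))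
         :^ (q₁ * q₂ * q₃)
  g (suc zero) (s≤s ())

-- Each of the polynomials is, up to a factor w^(q₁q₂q₃), a product
-- B₁₂^(q₁q₂) B₁₃^(q₁q₃) B₂₃^(q₂q₃) whose blocks Bᵢⱼ are products of linear forms.
--
-- Density at p.  Put x₂ = 1.  Close to the root 0, respectively -pⁱ, the values
-- are p^(em + c) tᵐ h up to high p-adic order, with m = q₁q₂, respectively
-- m = q₁q₃, and h a unit.  Modulo q₁ the offset c is q₂q₃ (q₁ + 1), respectively
-- q₂q₃ i, so i can be chosen to fix the valuation of a ratio modulo q₁; the two
-- exponents e then attain every such valuation because q₂ and q₃ are coprime.
-- As q₁q₃ is coprime to p (p - 1), the unit part can be adjusted through t.
--
-- Non-density at q.  If q is large and (x₁ , x₂) is not divisible by q, then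
-- linear forms from distinct blocks are not both divisible by q, hence the
-- valuation of a nonzero value is a multiple of q₁q₂, q₁q₃ or q₂q₃.  Two such
-- multiples are never consecutive, so ratios of values stay away from q.

module Submission where

-- The extra factors pⁱ x₁ + x₂ of g₂ answer an obstacle that f does not meet: if q divides both x₁
-- and x₂, all linear forms are divisible by q at once. These factors bring the blocks B₁₂, B₁₃, B₂₃
-- to the degrees q₃, q₂, q₁, so that each of the three powers is homogeneous of degree q₁q₂q₃. A
-- common factor of x₁ and x₂ therefore leaves the form as a q₁q₂q₃-th power and can be moved into
-- w, where it changes valuations only by multiples of all three products. At p the extra factors do
-- no harm: for x₂ = 1 they are congruent to 1 modulo p close to the roots in use.
--
-- The bound on q has the same source. Multiplied by suitable powers of p, every linear form except
-- x₁ becomes p^N x₁ + p^s x₂ with N = q₃ + q₂ - 2 and 0 ≤ s ≤ N + q₁ + 1. If two of them vanish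
-- modulo q, then q divides p^k - 1 for some k with 0 < k ≤ N + q₁ + 1 = q₃ + q₂ + q₁ - 1, which a
-- larger q cannot do. For f there are no such factors, N is 0, and the exponent is q₁ + 1.

open import Defs
open import Data.Nat.Base as ℕ using (ℕ; zero; suc; _+_; _*_; _∸_; _^_; _≤_; _<_; _!; NonZero; z≤n; s≤s)
open import Data.Nat.Coprimality as Coprime using (Coprime; prime⇒coprime)
open import Data.Nat.Primality using (Prime; euclidsLemma; prime⇒nonTrivial; prime⇒nonZero)
open import Data.Product.Base using (∃; ∃₂; _×_; _,_; proj₁; proj₂)
open import Relation.Nullary.Negation using (¬_)

import Algebra.Properties.CommutativeSemiring.Binomial as Binomial
open import Data.Empty using (⊥; ⊥-elim)
open import Data.Fin.Base using (Fin; zero; suc; toℕ; fromℕ; inject₁)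
import Data.Fin.Properties as Fin
open import Data.Integer.Base as ℤ using (ℤ; +_; -[1+_]; 0ℤ; 1ℤ; ∣_∣)
import Data.Integer.DivMod as ℤ
import Data.Integer.Divisibility.Signed as Signed
import Data.Integer.Properties as ℤ
open import Data.Integer.Tactic.RingSolver using (solve-∀)
open import Data.List.Base using (foldr; applyUpTo; tabulate; upTo)
open import Data.List.Membership.Propositional.Properties using (∈-upTo⁺)
open import Data.Nat.Combinatorics using (_C_; nCk≡n!/k![n-k]!; nCn≡1; k![n∸k]!∣n!)
open import Data.Nat.DivMod using (_%_; _/_; m≡m%n+[m/n]*n; m%n<n; m/n*n≡m)
open import Data.Nat.Divisibility as ℕ using (_∣_; _∤_; divides)
open import Data.Nat.GCD using (module Bézout)
import Data.Nat.Properties as ℕ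
import Data.Nat.Tactic.RingSolver as ℕ using (solve-∀)
open import Data.Rational.Base as ℚ using (ℚ)
open import Data.Rational.Literals using (fromℤ)
import Data.Rational.Properties as ℚ
import Data.Rational.Solver as ℚ
import Data.Rational.Unnormalised.Base as ℚᵘ
import Data.Rational.Unnormalised.Properties as ℚᵘ
open import Data.Sum.Base using (_⊎_; inj₁; inj₂; [_,_]′)
open import Data.Vec.Base using (Vec; []; _∷_; lookup; replicate)
open import Data.Vec.Functional using (Vector)
open import Data.Vec.Properties using (lookup-replicate)
open import Relation.Binary.Definitions using (tri<; tri≈; tri>)
open import Relation.Binary.PropositionalEquality
open import Relation.Nullary.Decidable.Core using (Dec; yes; no)
open import Algebra.Properties.Semiring.Sum ℕ.+-*-semiring using (sum; sum-init-last)
import Algebra.Properties.Semiring.Mult ℕ.+-*-semiring as Mult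
import Algebra.Properties.Semiring.Exp ℕ.+-*-semiring as Exp

-- Power residues modulo powers of a prime

∣-sum : ∀ {d n} (v : Vector ℕ n) → (∀ i → d ∣ v i) → d ∣ sum v
∣-sum {n = zero}  v d∣v = _ ℕ.∣0
∣-sum {n = suc n} v d∣v = ℕ.∣m∣n⇒∣m+n (d∣v zero) (∣-sum (λ i → v (suc i)) λ i → d∣v (suc i))

×≡* : ∀ n x → n Mult.× x ≡ n * x
×≡* zero    x = refl
×≡* (suc n) x = cong (_+_ x) (×≡* n x)

Exp^≡^ : ∀ x n → x Exp.^ n ≡ x ^ n
Exp^≡^ x zero    = refl
Exp^≡^ x (suc n) = cong (x *_) (Exp^≡^ x n)

prime∤! : ∀ {p} → Prime p → ∀ {n} → n < p → p ∤ n !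
prime∤! pp {zero}  n<p p∣ = ℕ.>⇒∤ (ℕ.nonTrivial⇒n>1 _ {{prime⇒nonTrivial pp}}) p∣
prime∤! pp {suc n} n<p p∣ with euclidsLemma (suc n) (n !) pp p∣
... | inj₁ p∣n = ℕ.>⇒∤ n<p p∣n
... | inj₂ p∣! = prime∤! pp (ℕ.<-trans (ℕ.n<1+n n) n<p) p∣!

-- p divides p ! = (p C k) · k ! · (p ∸ k) ! but neither of the two factorials, since k and p ∸ k
-- are below p.
prime∣C : ∀ {p} → Prime p → ∀ {k} → 0 < k → k < p → p ∣ p C k
prime∣C {p} pp {k} 0<k k<p with euclidsLemma (p C k) (k ! * (p ∸ k) !) pp p∣prod
  where
  instance _ = ℕ._!*_!≢0 k (p ∸ k)
  prod≡p! : (p C k) * (k ! * (p ∸ k) !) ≡ p !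
  prod≡p! = trans (cong (_* (k ! * (p ∸ k) !)) (nCk≡n!/k![n-k]! (ℕ.<⇒≤ k<p))) (m/n*n≡m (k![n∸k]!∣n! (ℕ.<⇒≤ k<p)))
  p∣p! : ∀ {n} → .{{NonZero n}} → n ∣ n !
  p∣p! {suc n} = ℕ.m∣m*n (n !)
  p∣prod : p ∣ (p C k) * (k ! * (p ∸ k) !)
  p∣prod = subst (p ∣_) (sym prod≡p!) (p∣p! {{prime⇒nonZero pp}})
... | inj₁ p∣C = p∣C
... | inj₂ p∣prod with euclidsLemma (k !) ((p ∸ k) !) pp p∣prod
...   | inj₁ p∣k! = ⊥-elim (prime∤! pp k<p p∣k!)
...   | inj₂ p∣l! = ⊥-elim (prime∤! pp (ℕ.∸-monoʳ-< 0<k (ℕ.<⇒≤ k<p)) p∣l!)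

freshman : ∀ {p} → Prime p → ∀ x → ∃ λ u → (x + 1) ^ p ≡ x ^ p + 1 + p * u
freshman {zero} pp x = ⊥-elim (ℕ.≢-nonZero⁻¹ 0 {{prime⇒nonZero pp}} refl)
freshman {suc n} pp x = ℕ.quotient mid , (begin
  (x + 1) ^ p                           ≡⟨ Exp^≡^ (x + 1) p ⟨
  (x + 1) Exp.^ p                       ≡⟨ B.theorem p x 1 ⟩
  term zero + sum (λ i → term (suc i))  ≡⟨ cong₂ _+_ first (trans (sum-init-last (λ i → term (suc i))) (cong₂ _+_ (ℕ.m∣n⇒n≡quotient*m mid) last)) ⟩
  1 + (ℕ.quotient mid * p + x ^ p)      ≡⟨ shuffle (ℕ.quotient mid * p) (x ^ p) ⟩
  x ^ p + 1 + ℕ.quotient mid * p        ≡⟨ cong (_+_ (x ^ p + 1)) (ℕ.*-comm (ℕ.quotient mid) p) ⟩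
  x ^ p + 1 + p * ℕ.quotient mid        ∎)
  where
  open ≡-Reasoning
  module B = Binomial ℕ.+-*-commutativeSemiring
  p = suc n
  term = B.binomialTerm x 1 p
  shuffle : ∀ a b → 1 + (a + b) ≡ b + 1 + a
  shuffle a b = trans (cong suc (ℕ.+-comm a b)) (cong (_+ a) (ℕ.+-comm 1 b))
  1^ : ∀ k → 1 Exp.^ k ≡ 1
  1^ k = trans (Exp^≡^ 1 k) (ℕ.^-zeroˡ k)
  first : term zero ≡ 1
  first = trans (×≡* 1 (1 * 1 Exp.^ p)) (trans (ℕ.*-identityˡ _) (trans (ℕ.*-identityˡ _) (1^ p)))
  last : term (suc (fromℕ n)) ≡ x ^ p
  last rewrite Fin.toℕ-fromℕ n | nCn≡1 p | ℕ.n∸n≡0 n = trans (ℕ.+-identityʳ _) (trans (ℕ.*-identityʳ _) (Exp^≡^ x p))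
  mid : p ∣ sum (λ i → term (suc (inject₁ i)))
  mid = ∣-sum _ λ i → subst (p ∣_) (sym (×≡* (p C suc (toℕ (inject₁ i))) _))
    (ℕ.∣m⇒∣m*n _ (prime∣C pp (s≤s z≤n) (s≤s (subst (_< n) (sym (Fin.toℕ-inject₁ i)) (Fin.toℕ<n i)))))

fermat : ∀ {p} → Prime p → ∀ x → ∃ λ u → x ^ p ≡ x + p * u
fermat {zero}  pp x = ⊥-elim (ℕ.≢-nonZero⁻¹ 0 {{prime⇒nonZero pp}} refl)
fermat {p@(suc _)} pp zero = 0 , sym (ℕ.*-zeroʳ p)
fermat {p} pp (suc x) with fermat pp x | freshman pp x
... | u , eq | v , eq′ = u + v , (begin
  suc x ^ p              ≡⟨ cong (_^ p) (ℕ.+-comm 1 x) ⟩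
  (x + 1) ^ p            ≡⟨ eq′ ⟩
  x ^ p + 1 + p * v      ≡⟨ cong (λ y → y + 1 + p * v) eq ⟩
  x + p * u + 1 + p * v  ≡⟨ rearrange x p u v ⟩
  suc x + p * (u + v)    ∎)
  where
  open ≡-Reasoning
  rearrange : ∀ x p u v → x + p * u + 1 + p * v ≡ suc x + p * (u + v)
  rearrange = ℕ.solve-∀

∣⇒multiple : ∀ {p z} → p ∣ ∣ z ∣ → ∃ λ u → z ≡ + p ℤ.* u
∣⇒multiple {p} p∣z with Signed.∣ᵤ⇒∣ {+ p} p∣z
... | Signed.divides u eq = u , trans eq (ℤ.*-comm u (+ p))

multiple⇒∣ : ∀ {p z u} → z ≡ + p ℤ.* u → p ∣ ∣ z ∣
multiple⇒∣ {p} {u = u} refl = divides ∣ u ∣ (trans (ℤ.abs-* (+ p) u) (ℕ.*-comm p ∣ u ∣))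

∤-* : ∀ {p} → Prime p → ∀ a b → p ∤ ∣ a ∣ → p ∤ ∣ b ∣ → p ∤ ∣ a ℤ.* b ∣
∤-* pp a b p∤a p∤b p∣ab = [ p∤a , p∤b ]′ (euclidsLemma ∣ a ∣ ∣ b ∣ pp (subst (_ ∣_) (ℤ.abs-* a b) p∣ab))

∤1 : ∀ {p} → Prime p → p ∤ 1
∤1 pp = ℕ.>⇒∤ (ℕ.nonTrivial⇒n>1 _ {{prime⇒nonTrivial pp}})

∤-^ : ∀ {p} → Prime p → ∀ a n → p ∤ ∣ a ∣ → p ∤ ∣ a ℤ.^ n ∣
∤-^ pp a zero    p∤a = ∤1 pp
∤-^ pp a (suc n) p∤a = ∤-* pp a (a ℤ.^ n) p∤a (∤-^ pp a n p∤a)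

pos-^ : ∀ (a n : ℕ) → + (a ^ n) ≡ (+ a) ℤ.^ n
pos-^ a zero    = refl
pos-^ a (suc n) = trans (ℤ.pos-* a (a ^ n)) (cong (ℤ._*_ (+ a)) (pos-^ a n))

^-distrib-* : ∀ a b n → (a ℤ.* b) ℤ.^ n ≡ a ℤ.^ n ℤ.* b ℤ.^ n
^-distrib-* a b zero    = refl
^-distrib-* a b (suc n) = trans (cong (ℤ._*_ (a ℤ.* b)) (^-distrib-* a b n)) (shuffle a b (a ℤ.^ n) (b ℤ.^ n))
  where
  shuffle : ∀ a b c d → a ℤ.* b ℤ.* (c ℤ.* d) ≡ a ℤ.* c ℤ.* (b ℤ.* d)
  shuffle = solve-∀

infix 4 _≈_[_]

-- The quotient is kept as data: after matching on `by u refl`, congruence laws become polynomial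
-- identities for the ring solver.
record _≈_[_] (a b n : ℤ) : Set where
  constructor by
  field
    quotient : ℤ
    equality : a ≡ b ℤ.+ n ℤ.* quotient

≈-reflexive : ∀ {a b n} → a ≡ b → a ≈ b [ n ]
≈-reflexive {b = b} {n} refl = by 0ℤ (identity b n)
  where
  identity : ∀ b n → b ≡ b ℤ.+ n ℤ.* 0ℤ
  identity = solve-∀

≈-sym : ∀ {a b n} → a ≈ b [ n ] → b ≈ a [ n ]
≈-sym {b = b} {n} (by u refl) = by (ℤ.- u) (identity b n u)
  where
  identity : ∀ b n u → b ≡ b ℤ.+ n ℤ.* u ℤ.+ n ℤ.* ℤ.- u
  identity = solve-∀

≈-trans : ∀ {a b c n} → a ≈ b [ n ] → b ≈ c [ n ] → a ≈ c [ n ]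
≈-trans {c = c} {n} (by u refl) (by v refl) = by (u ℤ.+ v) (identity c n u v)
  where
  identity : ∀ c n u v → c ℤ.+ n ℤ.* v ℤ.+ n ℤ.* u ≡ c ℤ.+ n ℤ.* (u ℤ.+ v)
  identity = solve-∀

≈-* : ∀ {a b c d n} → a ≈ b [ n ] → c ≈ d [ n ] → a ℤ.* c ≈ b ℤ.* d [ n ]
≈-* {b = b} {d = d} {n} (by u refl) (by v refl) = by (b ℤ.* v ℤ.+ u ℤ.* d ℤ.+ n ℤ.* u ℤ.* v) (identity b d n u v)
  where
  identity : ∀ b d n u v → (b ℤ.+ n ℤ.* u) ℤ.* (d ℤ.+ n ℤ.* v) ≡ b ℤ.* d ℤ.+ n ℤ.* (b ℤ.* v ℤ.+ u ℤ.* d ℤ.+ n ℤ.* u ℤ.* v)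
  identity = solve-∀

≈-^ : ∀ {a b n} → a ≈ b [ n ] → ∀ k → a ℤ.^ k ≈ b ℤ.^ k [ n ]
≈-^ a≈b zero    = ≈-reflexive refl
≈-^ a≈b (suc k) = ≈-* a≈b (≈-^ a≈b k)

≈-weaken : ∀ {a b m n} → a ≈ b [ m ℤ.* n ] → a ≈ b [ n ]
≈-weaken {b = b} {m} {n} (by u refl) = by (m ℤ.* u) (identity b m n u)
  where
  identity : ∀ b m n u → b ℤ.+ m ℤ.* n ℤ.* u ≡ b ℤ.+ n ℤ.* (m ℤ.* u)
  identity = solve-∀

≈-∤ : ∀ {p a b} → a ≈ b [ + p ] → p ∤ ∣ b ∣ → p ∤ ∣ a ∣
≈-∤ {p} {a} {b} (by u refl) p∤b p∣a with ∣⇒multiple {p} {a} p∣a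
... | v , eq = p∤b (multiple⇒∣ {u = v ℤ.- u} (identity eq))
  where
  cancel : ∀ b n u → b ≡ b ℤ.+ n ℤ.* u ℤ.- n ℤ.* u
  cancel = solve-∀
  factor : ∀ n v u → n ℤ.* v ℤ.- n ℤ.* u ≡ n ℤ.* (v ℤ.- u)
  factor = solve-∀
  identity : b ℤ.+ + p ℤ.* u ≡ + p ℤ.* v → b ≡ + p ℤ.* (v ℤ.- u)
  identity eq = trans (cancel b (+ p) u) (trans (cong (ℤ._- + p ℤ.* u) eq) (factor (+ p) v u))

[1+y]^n : ∀ y n → ∃ λ z → (1ℤ ℤ.+ y) ℤ.^ n ≡ 1ℤ ℤ.+ + n ℤ.* y ℤ.+ y ℤ.* y ℤ.* z
[1+y]^n y zero    = 0ℤ , identity y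
  where
  identity : ∀ y → 1ℤ ≡ 1ℤ ℤ.+ 0ℤ ℤ.* y ℤ.+ y ℤ.* y ℤ.* 0ℤ
  identity = solve-∀
[1+y]^n y (suc n) with [1+y]^n y n
... | z , eq = z ℤ.+ + n ℤ.+ y ℤ.* z , trans (cong (ℤ._*_ (1ℤ ℤ.+ y)) eq) (identity y (+ n) z)
  where
  identity : ∀ y n z → (1ℤ ℤ.+ y) ℤ.* (1ℤ ℤ.+ n ℤ.* y ℤ.+ y ℤ.* y ℤ.* z)
    ≡ 1ℤ ℤ.+ (1ℤ ℤ.+ n) ℤ.* y ℤ.+ y ℤ.* y ℤ.* (z ℤ.+ n ℤ.+ y ℤ.* z)
  identity = solve-∀

-- Write x = 1 + y with y divisible by p^(k+1). In the expansion of (1 + y)^p the linear term p y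
-- gains a factor p, and the rest is divisible by y², hence by p^(2k+2) and so by p^(k+2).
≈1-lift : ∀ p k {x} → x ≈ 1ℤ [ (+ p) ℤ.^ suc k ] → x ℤ.^ p ≈ 1ℤ [ (+ p) ℤ.^ suc (suc k) ]
≈1-lift p k (by u refl) with [1+y]^n ((+ p) ℤ.^ suc k ℤ.* u) p
... | z , eq = by (u ℤ.+ (+ p) ℤ.^ k ℤ.* u ℤ.* u ℤ.* z) (trans eq (identity (+ p) ((+ p) ℤ.^ k) u z))
  where
  identity : ∀ p q u z → 1ℤ ℤ.+ p ℤ.* (p ℤ.* q ℤ.* u) ℤ.+ (p ℤ.* q ℤ.* u) ℤ.* (p ℤ.* q ℤ.* u) ℤ.* z
    ≡ 1ℤ ℤ.+ p ℤ.* (p ℤ.* q) ℤ.* (u ℤ.+ q ℤ.* u ℤ.* u ℤ.* z)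
  identity = solve-∀

-- `fermat` speaks of natural numbers, so a is replaced by its residue r; then r is cancelled from r
-- (r^(p-1) - 1), a multiple of p.
euler-base : ∀ {p} → Prime p → ∀ a → p ∤ ∣ a ∣ → a ℤ.^ (p ∸ 1) ≈ 1ℤ [ + p ]
euler-base {zero}  pp a p∤a = ⊥-elim (ℕ.≢-nonZero⁻¹ 0 {{prime⇒nonZero pp}} refl)
euler-base {p@(suc p-1)} pp a p∤a = ≈-trans (≈-^ a≈r p-1) r^[p-1]≈1
  where
  r = a ℤ.%ℕ p
  a≈r : a ≈ + r [ + p ]
  a≈r = by (a ℤ./ℕ p) (trans (ℤ.a≡a%ℕn+[a/ℕn]*n a p) (cong (ℤ._+_ (+ r)) (ℤ.*-comm (a ℤ./ℕ p) (+ p))))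
  p∤r : p ∤ r
  p∤r = ≈-∤ {a = + r} {a} (≈-sym a≈r) p∤a
  factor : ∀ r s n u → r ℤ.* s ≡ r ℤ.+ n ℤ.* u → r ℤ.* (s ℤ.- 1ℤ) ≡ n ℤ.* u
  factor r s n u eq = trans (expand r s) (trans (cong (ℤ._- r) eq) (cancel r (n ℤ.* u)))
    where
    expand : ∀ r s → r ℤ.* (s ℤ.- 1ℤ) ≡ r ℤ.* s ℤ.- r
    expand = solve-∀
    cancel : ∀ r t → r ℤ.+ t ℤ.- r ≡ t
    cancel = solve-∀
  restore : ∀ s t → s ℤ.- 1ℤ ≡ t → s ≡ 1ℤ ℤ.+ t
  restore s t refl = identity s
    where
    identity : ∀ s → s ≡ 1ℤ ℤ.+ (s ℤ.- 1ℤ)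
    identity = solve-∀
  r^[p-1]≈1 : (+ r) ℤ.^ p-1 ≈ 1ℤ [ + p ]
  r^[p-1]≈1 with fermat pp r
  ... | u , eq with euclidsLemma r _ pp (subst (p ∣_) (ℤ.abs-* (+ r) ((+ r) ℤ.^ p-1 ℤ.- 1ℤ)) (multiple⇒∣ (factor (+ r) ((+ r) ℤ.^ p-1) (+ p) (+ u) eqℤ)))
    where
    eqℤ : (+ r) ℤ.^ p ≡ + r ℤ.+ + p ℤ.* + u
    eqℤ = trans (sym (pos-^ r p)) (trans (cong +_ eq) (cong (ℤ._+_ (+ r)) (ℤ.pos-* p u)))
  ...   | inj₁ p∣r = ⊥-elim (p∤r p∣r)
  ...   | inj₂ p∣s with ∣⇒multiple {p} {(+ r) ℤ.^ p-1 ℤ.- 1ℤ} p∣s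
  ...     | v , eq′ = by v (restore _ _ eq′)

-- Each further power of p in the modulus costs one p-th power, which leads from p - 1 to
-- φ(p^(k+1)).
euler : ∀ {p} → Prime p → ∀ k a → p ∤ ∣ a ∣ → a ℤ.^ ((p ∸ 1) * p ^ k) ≈ 1ℤ [ (+ p) ℤ.^ suc k ]
euler {p} pp zero a p∤a = subst₂ (λ e n → a ℤ.^ e ≈ 1ℤ [ n ])
  (sym (ℕ.*-identityʳ (p ∸ 1))) (sym (ℤ.*-identityʳ (+ p))) (euler-base pp a p∤a)
euler {p} pp (suc k) a p∤a = subst (_≈ 1ℤ [ _ ]) (trans (ℤ.^-*-assoc a ((p ∸ 1) * p ^ k) p)
  (cong (ℤ._^_ a) (trans (ℕ.*-assoc (p ∸ 1) (p ^ k) p) (cong (_*_ (p ∸ 1)) (ℕ.*-comm (p ^ k) p)))))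
  (≈1-lift p k (euler pp k a p∤a))

private
  bézout⁺ : ∀ m n a b E x y → x * suc m ≡ 1 + y * suc n →
    ∃₂ λ e e′ → E ≤ e × E ≤ e′ × e * suc m + a ≡ e′ * suc n + b
  bézout⁺ m n a b E x y eq =
    -- `b + a * n` is congruent to b - a modulo `suc n` and avoids subtraction. Adding E times the
    -- opposite modulus to each multiplier keeps the equation and makes both at least E.
    x * (b + a * n) + E * suc n , y * (b + a * n) + a + E * suc m ,
    ℕ.≤-trans (ℕ.m≤m*n E (suc n)) (ℕ.m≤n+m _ _) ,
    ℕ.≤-trans (ℕ.m≤m*n E (suc m)) (ℕ.m≤n+m _ _) , (begin
    (x * (b + a * n) + E * suc n) * suc m + a                    ≡⟨ expand x (b + a * n) E m n a ⟩
    x * suc m * (b + a * n) + E * suc n * suc m + a              ≡⟨ cong (λ t → t * (b + a * n) + E * suc n * suc m + a) eq ⟩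
    (1 + y * suc n) * (b + a * n) + E * suc n * suc m + a        ≡⟨ collect y b a n m E ⟩
    (y * (b + a * n) + a + E * suc m) * suc n + b                ∎)
    where
    open ≡-Reasoning
    expand : ∀ x c E m n a → (x * c + E * suc n) * suc m + a ≡ x * suc m * c + E * suc n * suc m + a
    expand = ℕ.solve-∀
    collect : ∀ y b a n m E → (1 + y * suc n) * (b + a * n) + E * suc n * suc m + a ≡ (y * (b + a * n) + a + E * suc m) * suc n + b
    collect = ℕ.solve-∀

-- Two arithmetic progressions with coprime differences meet arbitrarily far out. The lower bound E
-- is there because expansions near a root hold only for large exponents. The equation is symmetric,
-- so one sign of Bézout's identity suffices.
coprime-balance : ∀ {m n} .{{m≢0 : NonZero m}} .{{n≢0 : NonZero n}} → Coprime m n → ∀ a b E →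
  ∃₂ λ e e′ → E ≤ e × E ≤ e′ × e * m + a ≡ e′ * n + b
coprime-balance {suc m} {suc n} cop a b E with Coprime.coprime-Bézout cop
... | Bézout.+- x y eq = bézout⁺ m n a b E x y (sym eq)
... | Bézout.-+ x y eq with bézout⁺ n m b a E y x (sym eq)
...   | e , e′ , E≤e , E≤e′ , eq′ = e′ , e , E≤e′ , E≤e , sym eq′

coprime-*ʳ : ∀ {m n o} → Coprime m n → Coprime m o → Coprime m (n * o)
coprime-*ʳ m⊥n m⊥o (d∣m , d∣no) =
  m⊥o (d∣m , Coprime.coprime-divisor (λ (e∣d , e∣n) → m⊥n (ℕ.∣-trans e∣d d∣m , e∣n)) d∣no)

coprime-^ʳ : ∀ {m n} k → Coprime m n → Coprime m (n ^ k)
coprime-^ʳ zero    m⊥n = Coprime.sym (Coprime.1-coprimeTo _)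
coprime-^ʳ (suc k) m⊥n = coprime-*ʳ m⊥n (coprime-^ʳ k m⊥n)

φ≢0 : ∀ {p} → Prime p → ∀ k → NonZero ((p ∸ 1) * p ^ k)
φ≢0 {p} pp k = ℕ.m*n≢0 (p ∸ 1) (p ^ k)
  {{ℕ.>-nonZero (ℕ.m<n⇒0<n∸m (ℕ.nonTrivial⇒n>1 p {{prime⇒nonTrivial pp}}))}} {{ℕ.m^n≢0 p k {{prime⇒nonZero pp}}}}

-- m is invertible modulo the order φ of the unit group, so raising to the m-th power permutes the
-- units: with e m ≡ 1 modulo φ, every unit c is the m-th power of c^e. This is applied to c = b /
-- a.
power-residue : ∀ {p m} .{{_ : NonZero m}} → Prime p → Coprime m (p ∸ 1) → Coprime m p →
  ∀ K a b → p ∤ ∣ a ∣ → p ∤ ∣ b ∣ → ∃ λ (t : ℤ) → t ℤ.^ m ℤ.* a ≈ b [ (+ p) ℤ.^ K ]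
power-residue {p} {m} pp m⊥p-1 m⊥p K a b p∤a p∤b
  -- The offsets 0 and 1 make this the equation e m = e′ φ + 1.
  with coprime-balance {{n≢0 = φ≢0 pp K}} (coprime-*ʳ m⊥p-1 (coprime-^ʳ K m⊥p)) 0 1 0
... | e , e′ , _ , _ , eq = c ℤ.^ e , ≈-weaken {m = + p} (≈-trans (≈-* c^em≈c (≈-reflexive refl)) ca≈b)
  where
  φ = (p ∸ 1) * p ^ K
  -- By Euler's theorem a^(φ-1) is an inverse of a, so c plays the role of b / a.
  c = b ℤ.* a ℤ.^ (φ ∸ 1)
  p∤c = ∤-* pp b (a ℤ.^ (φ ∸ 1)) p∤b (∤-^ pp a (φ ∸ 1) p∤a)
  1+[φ-1] : suc (φ ∸ 1) ≡ φ
  1+[φ-1] = ℕ.m+[n∸m]≡n (ℕ.>-nonZero⁻¹ φ {{φ≢0 pp K}})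
  a·a^[φ-1]≈1 : a ℤ.* a ℤ.^ (φ ∸ 1) ≈ 1ℤ [ (+ p) ℤ.^ suc K ]
  a·a^[φ-1]≈1 = subst (λ n → a ℤ.^ n ≈ 1ℤ [ (+ p) ℤ.^ suc K ]) (sym 1+[φ-1]) (euler pp K a p∤a)
  ca≈b : c ℤ.* a ≈ b [ (+ p) ℤ.^ suc K ]
  ca≈b = ≈-trans (≈-reflexive (trans (ℤ.*-assoc b _ a) (cong (b ℤ.*_) (ℤ.*-comm _ a))))
    (≈-trans (≈-* {b = b} (≈-reflexive refl) a·a^[φ-1]≈1) (≈-reflexive (ℤ.*-identityʳ b)))
  exponent : (c ℤ.^ e) ℤ.^ m ≡ (c ℤ.^ φ) ℤ.^ e′ ℤ.* c
  exponent = begin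
    (c ℤ.^ e) ℤ.^ m                ≡⟨ ℤ.^-*-assoc c e m ⟩
    c ℤ.^ (e * m)                  ≡⟨ cong (c ℤ.^_) (trans (sym (ℕ.+-identityʳ _)) eq) ⟩
    c ℤ.^ (e′ * φ + 1)         ≡⟨ ℤ.^-distribˡ-+-* c (e′ * φ) 1 ⟩
    c ℤ.^ (e′ * φ) ℤ.* c ℤ.^ 1 ≡⟨ cong₂ ℤ._*_ (trans (cong (c ℤ.^_) (ℕ.*-comm e′ (φ))) (sym (ℤ.^-*-assoc c (φ) e′))) (ℤ.^-identityʳ c) ⟩
    (c ℤ.^ φ) ℤ.^ e′ ℤ.* c     ∎
    where open ≡-Reasoning
  c^em≈c : (c ℤ.^ e) ℤ.^ m ≈ c [ (+ p) ℤ.^ suc K ]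
  c^em≈c = ≈-trans (≈-reflexive exponent) (≈-trans (≈-* (≈-trans (≈-^ (euler pp K c p∤c) e′) (≈-reflexive (ℤ.^-zeroˡ e′))) (≈-reflexive refl)) (≈-reflexive (ℤ.*-identityˡ c)))

-- Leading terms near a root

-- The common power of p is removed by descent on ∣ x ∣, which ends because x is nonzero; y may
-- vanish and is only carried along. The result is a pair (u , v) that is not divisible by p.
split₂ : ∀ {p} → Prime p → ∀ x y → x ≢ 0ℤ → ∃ λ d → ∃₂ λ u v →
  x ≡ (+ p) ℤ.^ d ℤ.* u × y ≡ (+ p) ℤ.^ d ℤ.* v × ¬ ((p ∣ ∣ u ∣) × (p ∣ ∣ v ∣))
split₂ {p} pp x y x≢0 = go (suc ∣ x ∣) x y x≢0 ℕ.≤-refl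
  where
  done : ∀ x → x ≡ 1ℤ ℤ.* x
  done = solve-∀
  step : ∀ {x u w} d → x ≡ + p ℤ.* u → u ≡ (+ p) ℤ.^ d ℤ.* w → x ≡ (+ p) ℤ.^ suc d ℤ.* w
  step {w = w} d refl refl = sym (ℤ.*-assoc (+ p) ((+ p) ℤ.^ d) w)
  go : ∀ n x y → x ≢ 0ℤ → ∣ x ∣ < n → ∃ λ d → ∃₂ λ u v →
    x ≡ (+ p) ℤ.^ d ℤ.* u × y ≡ (+ p) ℤ.^ d ℤ.* v × ¬ ((p ∣ ∣ u ∣) × (p ∣ ∣ v ∣))
  go (suc n) x y x≢0 (s≤s ∣x∣≤n) with p ℕ.∣? ∣ x ∣ | p ℕ.∣? ∣ y ∣
  ... | no p∤x  | _       = 0 , x , y , done x , done y , λ (p∣x , _) → p∤x p∣x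
  ... | yes _   | no p∤y  = 0 , x , y , done x , done y , λ (_ , p∣y) → p∤y p∣y
  ... | yes p∣x | yes p∣y with ∣⇒multiple {p} {x} p∣x | ∣⇒multiple {p} {y} p∣y
  ...   | u , refl | v , refl with go n u v u≢0 (ℕ.<-≤-trans ∣u∣<∣pu∣ ∣x∣≤n)
    where
    u≢0 : u ≢ 0ℤ
    u≢0 refl = x≢0 (ℤ.*-zeroʳ (+ p))
    ∣u∣<∣pu∣ : ∣ u ∣ < ∣ + p ℤ.* u ∣
    ∣u∣<∣pu∣ = subst (∣ u ∣ <_) (trans (ℕ.*-comm ∣ u ∣ p) (sym (ℤ.abs-* (+ p) u)))
      (ℕ.m<m*n ∣ u ∣ p {{ℤ.≢-nonZero u≢0}} (ℕ.nonTrivial⇒n>1 p {{prime⇒nonTrivial pp}}))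
  ...     | d , u′ , v′ , eq , eq′ , prim = suc d , u′ , v′ , step d refl eq , step d refl eq′ , prim

split : ∀ {p} → Prime p → ∀ x → x ≢ 0ℤ → ∃₂ λ d u → x ≡ (+ p) ℤ.^ d ℤ.* u × p ∤ ∣ u ∣
-- Against the second entry 0 the cofactor v is 0 as well, hence divisible by p, and primitivity of
-- the pair falls on u alone.
split {p} pp x x≢0 with split₂ pp x 0ℤ x≢0
... | d , u , v , x≡ , 0≡ , prim = d , u , x≡ , λ p∣u → prim (p∣u , p∣v)
  where
  p∣v : p ∣ ∣ v ∣
  p∣v with ℤ.i*j≡0⇒i≡0∨j≡0 ((+ p) ℤ.^ d) (sym 0≡)
  ... | inj₂ refl = p ℕ.∣0
  ... | inj₁ p^d≡0 with ℤ.i^n≡0⇒i≡0 (+ p) d p^d≡0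
  ...   | refl = ⊥-elim (ℕ.≢-nonZero⁻¹ 0 {{prime⇒nonZero pp}} refl)

-- The recursion shifts the function as `applyUpTo` does, so that evaluating a list product of
-- polynomials follows it clause by clause.
∏ : (ℕ → ℤ) → ℕ → ℤ
∏ φ zero    = 1ℤ
∏ φ (suc n) = φ 0 ℤ.* ∏ (λ j → φ (suc j)) n

module _ {p : ℕ} (pp : Prime p) (K : ℕ) where

  private
    P = + p

  -- z e t = p^(c + em) (tᵐ h + O(p^K)) for large e, where h = coefficient: e and t
  -- parametrise the points ρ + pᵉ t near a root ρ of multiplicity m.
  record Leading (z : ℕ → ℤ → ℤ) (m c : ℕ) : Set where
    field
      threshold   : ℕ
      coefficient : ℤ
      unit        : p ∤ ∣ coefficient ∣
      expansion   : ∀ e t → threshold ≤ e →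
        z e t ≈ P ℤ.^ (c + e * m) ℤ.* (t ℤ.^ m ℤ.* coefficient) [ P ℤ.^ (c + e * m) ℤ.* P ℤ.^ K ]

  leading-cast : ∀ {z m m′ c c′} → m ≡ m′ → c ≡ c′ → Leading z m c → Leading z m′ c′
  leading-cast refl refl lead = lead

  -- For a factor that does not vanish at the centre, the perturbation b pᵉ t is absorbed by the
  -- error p^(c+K) as soon as e ≥ c + K, which is the threshold.
  leading-linear : ∀ {z} c h b → p ∤ ∣ h ∣ → (∀ e t → z e t ≡ P ℤ.^ c ℤ.* h ℤ.+ b ℤ.* (P ℤ.^ e ℤ.* t)) → Leading z 0 c
  leading-linear {z} c h b p∤h z≡ = record
    { threshold = c + K ; coefficient = h ; unit = p∤h ; expansion = expansion }
    where
    identity : ∀ c k r h b t → c ℤ.* h ℤ.+ b ℤ.* (c ℤ.* k ℤ.* r ℤ.* t) ≡ c ℤ.* (1ℤ ℤ.* h) ℤ.+ c ℤ.* k ℤ.* (b ℤ.* (r ℤ.* t))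
    identity = solve-∀
    expansion : ∀ e t → c + K ≤ e →
      z e t ≈ P ℤ.^ (c + e * 0) ℤ.* (t ℤ.^ 0 ℤ.* h) [ P ℤ.^ (c + e * 0) ℤ.* P ℤ.^ K ]
    expansion e t c+K≤e rewrite ℕ.*-zeroʳ e | ℕ.+-identityʳ c | z≡ e t =
      by (b ℤ.* (P ℤ.^ (e ∸ (c + K)) ℤ.* t)) (trans
        (cong (λ y → P ℤ.^ c ℤ.* h ℤ.+ b ℤ.* (y ℤ.* t)) P^e≡)
        (identity (P ℤ.^ c) (P ℤ.^ K) (P ℤ.^ (e ∸ (c + K))) h b t))
      where
      P^e≡ : P ℤ.^ e ≡ P ℤ.^ c ℤ.* P ℤ.^ K ℤ.* P ℤ.^ (e ∸ (c + K))
      P^e≡ = trans (cong (P ℤ.^_) (sym (ℕ.m+[n∸m]≡n c+K≤e)))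
        (trans (ℤ.^-distribˡ-+-* P (c + K) _) (cong (ℤ._* P ℤ.^ (e ∸ (c + K))) (ℤ.^-distribˡ-+-* P c K)))

  leading-root : ∀ {z} → (∀ e t → z e t ≡ P ℤ.^ e ℤ.* t) → Leading z 1 0
  leading-root {z} z≡ = record
    { threshold = 0 ; coefficient = 1ℤ ; unit = ∤1 pp ; expansion = expansion }
    where
    identity : ∀ x t → x ℤ.* t ≡ x ℤ.* (t ℤ.* 1ℤ ℤ.* 1ℤ)
    identity = solve-∀
    expansion : ∀ e t → 0 ≤ e → z e t ≈ P ℤ.^ (e * 1) ℤ.* (t ℤ.^ 1 ℤ.* 1ℤ) [ P ℤ.^ (e * 1) ℤ.* P ℤ.^ K ]
    expansion e t _ rewrite ℕ.*-identityʳ e = ≈-reflexive (trans (z≡ e t) (identity (P ℤ.^ e) t))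

  leading-1 : Leading (λ _ _ → 1ℤ) 0 0
  leading-1 = leading-linear 0 1ℤ 0ℤ (∤1 pp) λ _ _ → refl

  -- The error p^K is relative to the leading power of p, so a product keeps the precision K, while
  -- multiplicities and offsets add and unit coefficients multiply.
  leading-* : ∀ {y z m n c d} → Leading y m c → Leading z n d → Leading (λ e t → y e t ℤ.* z e t) (m + n) (c + d)
  leading-* {y} {z} {m} {n} {c} {d} L M = record
    { threshold   = L.threshold ℕ.⊔ M.threshold
    ; coefficient = L.coefficient ℤ.* M.coefficient
    ; unit        = ∤-* pp L.coefficient M.coefficient L.unit M.unit
    ; expansion   = λ e t bound → combine e t (L.expansion e t (ℕ.m⊔n≤o⇒m≤o _ _ bound)) (M.expansion e t (ℕ.m⊔n≤o⇒n≤o _ _ bound))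
    }
    where
    module L = Leading L
    module M = Leading M
    exponents : ∀ c m d n e → (c + d) + e * (m + n) ≡ (c + e * m) + (d + e * n)
    exponents = ℕ.solve-∀
    identity : ∀ a b k s t h i u v → (a ℤ.* (s ℤ.* h) ℤ.+ a ℤ.* k ℤ.* u) ℤ.* (b ℤ.* (t ℤ.* i) ℤ.+ b ℤ.* k ℤ.* v)
      ≡ a ℤ.* b ℤ.* (s ℤ.* t ℤ.* (h ℤ.* i)) ℤ.+ a ℤ.* b ℤ.* k ℤ.* (s ℤ.* h ℤ.* v ℤ.+ t ℤ.* i ℤ.* u ℤ.+ k ℤ.* u ℤ.* v)
    identity = solve-∀
    combine : ∀ e t →
      y e t ≈ P ℤ.^ (c + e * m) ℤ.* (t ℤ.^ m ℤ.* L.coefficient) [ P ℤ.^ (c + e * m) ℤ.* P ℤ.^ K ] →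
      z e t ≈ P ℤ.^ (d + e * n) ℤ.* (t ℤ.^ n ℤ.* M.coefficient) [ P ℤ.^ (d + e * n) ℤ.* P ℤ.^ K ] →
      y e t ℤ.* z e t ≈ P ℤ.^ ((c + d) + e * (m + n)) ℤ.* (t ℤ.^ (m + n) ℤ.* (L.coefficient ℤ.* M.coefficient))
        [ P ℤ.^ ((c + d) + e * (m + n)) ℤ.* P ℤ.^ K ]
    combine e t (by u eq) (by v eq′)
      rewrite eq | eq′ | exponents c m d n e | ℤ.^-distribˡ-+-* P (c + e * m) (d + e * n) | ℤ.^-distribˡ-+-* t m n =
      by _ (identity (P ℤ.^ (c + e * m)) (P ℤ.^ (d + e * n)) (P ℤ.^ K) (t ℤ.^ m) (t ℤ.^ n) L.coefficient M.coefficient u v)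

  leading-^ : ∀ {z m c} → Leading z m c → ∀ n → Leading (λ e t → z e t ℤ.^ n) (n * m) (n * c)
  leading-^ L zero    = leading-1
  leading-^ L (suc n) = leading-* L (leading-^ L n)

  leading-∏-units : ∀ {φ : ℕ → ℕ → ℤ → ℤ} n → (∀ j → Leading (φ j) 0 0) → Leading (λ e t → ∏ (λ j → φ j e t) n) 0 0
  leading-∏-units zero    L = leading-1
  leading-∏-units (suc n) L = leading-* (L 0) (leading-∏-units n λ j → L (suc j))

  -- Only the existence of the offset is recorded: it will enter multiplied by q₁q₃, and so does not
  -- affect anything modulo q₁.
  leading-∏-nonroots : ∀ {φ : ℕ → ℕ → ℤ → ℤ} n → (∀ j → ∃ λ c → Leading (φ j) 0 c) → ∃ λ c → Leading (λ e t → ∏ (λ j → φ j e t) n) 0 c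
  leading-∏-nonroots zero    L = 0 , leading-1
  leading-∏-nonroots (suc n) L = _ , leading-* (proj₂ (L 0)) (proj₂ (leading-∏-nonroots n λ j → L (suc j)))

  leading-∏-root : ∀ {φ : ℕ → ℕ → ℤ → ℤ} {n i} → i < n → Leading (φ i) 1 0 → (∀ j → j ≢ i → ∃ λ c → Leading (φ j) 0 c) →
    ∃ λ c → Leading (λ e t → ∏ (λ j → φ j e t) n) 1 c
  leading-∏-root {φ} {suc n} {zero} _ root L = _ , leading-* root (proj₂ (leading-∏-nonroots {λ j → φ (suc j)} n λ j → L (suc j) λ ()))
  leading-∏-root {φ} {suc n} {suc i} (s≤s i<n) root L =
    _ , leading-* (proj₂ (L 0 λ ())) (proj₂ (leading-∏-root {λ j → φ (suc j)} i<n root λ j j≢i → L (suc j) λ eq → j≢i (ℕ.suc-injective eq)))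

-- G x / G y approximates n / d to precision k; `close` is cleared of denominators.
record Approximation (p : ℕ) (G : ℤ → ℤ) (n d : ℤ) (k : ℕ) : Set where
  field
    x y u w : ℤ
    Gy≢0    : G y ≢ 0ℤ
    p∤w     : p ∤ ∣ w ∣
    close   : (n ℤ.* G y ℤ.- G x ℤ.* d) ℤ.* w ≡ (+ p) ℤ.^ k ℤ.* u ℤ.* (d ℤ.* G y)

-- From leading terms to approximation of rational numbers

module _ {p : ℕ} (pp : Prime p) where
  private
    P = + p

  P^≢0 : ∀ n → P ℤ.^ n ≢ 0ℤ
  P^≢0 n eq with ℤ.i^n≡0⇒i≡0 P n eq
  ... | refl = ℕ.≢-nonZero⁻¹ 0 {{prime⇒nonZero pp}} refl

  ∤⇒≢0 : ∀ {z} → p ∤ ∣ z ∣ → z ≢ 0ℤ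
  ∤⇒≢0 p∤z refl = p∤z (p ℕ.∣0)

  *-≢0 : ∀ x y → x ≢ 0ℤ → y ≢ 0ℤ → x ℤ.* y ≢ 0ℤ
  *-≢0 x y x≢0 y≢0 eq = [ x≢0 , y≢0 ]′ (ℤ.i*j≡0⇒i≡0∨j≡0 x eq)

  -- The equation A + β = B + α says that G x / G y and the target have the same valuation. Their
  -- difference is then p^(α-β) (n Y - X d) / (Y d), so a congruence modulo p^(k+β) gives precision
  -- k whatever α is.
  approximate-units : ∀ G x y {A B X Y α β n d} k → p ∤ ∣ Y ∣ → p ∤ ∣ d ∣ →
    G x ≡ P ℤ.^ A ℤ.* X → G y ≡ P ℤ.^ B ℤ.* Y → A + β ≡ B + α → X ℤ.* d ≈ n ℤ.* Y [ P ℤ.^ (k + β) ] →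
    Approximation p G (P ℤ.^ α ℤ.* n) (P ℤ.^ β ℤ.* d) k
  approximate-units G x y {A} {B} {X} {Y} {α} {β} {n} {d} k p∤Y p∤d Gx≡ Gy≡ A+β≡B+α (by u Xd≡) = record
    { x = x ; y = y ; u = ℤ.- (P ℤ.^ α ℤ.* u) ; w = Y ℤ.* d
    ; Gy≢0 = subst (_≢ 0ℤ) (sym Gy≡) (*-≢0 (P ℤ.^ B) Y (P^≢0 B) (∤⇒≢0 {Y} p∤Y))
    ; p∤w = ∤-* pp Y d p∤Y p∤d
    ; close = subst₂ (λ X Z → (P ℤ.^ α ℤ.* n ℤ.* Z ℤ.- X ℤ.* (P ℤ.^ β ℤ.* d)) ℤ.* (Y ℤ.* d)
          ≡ P ℤ.^ k ℤ.* ℤ.- (P ℤ.^ α ℤ.* u) ℤ.* (P ℤ.^ β ℤ.* d ℤ.* Z))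
        (sym Gx≡) (sym Gy≡)
        (trans (expand (P ℤ.^ α) (P ℤ.^ β) (P ℤ.^ A) (P ℤ.^ B) n d X Y)
          (trans (cong₂ (λ s t → (P ℤ.^ α ℤ.* P ℤ.^ B ℤ.* (n ℤ.* Y) ℤ.- s ℤ.* t) ℤ.* (Y ℤ.* d)) powers
            (trans Xd≡ (cong (λ r → n ℤ.* Y ℤ.+ r ℤ.* u) (ℤ.^-distribˡ-+-* P k β))))
            (collect (P ℤ.^ α) (P ℤ.^ β) (P ℤ.^ B) (P ℤ.^ k) n d Y u)))
    }
    where
    powers : P ℤ.^ A ℤ.* P ℤ.^ β ≡ P ℤ.^ α ℤ.* P ℤ.^ B
    powers = trans (sym (ℤ.^-distribˡ-+-* P A β)) (trans (cong (P ℤ.^_) (trans A+β≡B+α (ℕ.+-comm B α))) (ℤ.^-distribˡ-+-* P α B))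
    expand : ∀ a b A B n d X Y → (a ℤ.* n ℤ.* (B ℤ.* Y) ℤ.- A ℤ.* X ℤ.* (b ℤ.* d)) ℤ.* (Y ℤ.* d)
      ≡ (a ℤ.* B ℤ.* (n ℤ.* Y) ℤ.- A ℤ.* b ℤ.* (X ℤ.* d)) ℤ.* (Y ℤ.* d)
    expand = solve-∀
    collect : ∀ a b B k n d Y u → (a ℤ.* B ℤ.* (n ℤ.* Y) ℤ.- a ℤ.* B ℤ.* (n ℤ.* Y ℤ.+ k ℤ.* b ℤ.* u)) ℤ.* (Y ℤ.* d)
      ≡ k ℤ.* ℤ.- (a ℤ.* u) ℤ.* (b ℤ.* d ℤ.* (B ℤ.* Y))
    collect = solve-∀

  -- The exponents e and e₀ settle the valuation through `balance`. The unit part is then matched by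
  -- t in the numerator alone, the denominator being evaluated at t = 1.
  approximate : ∀ (G : ℤ → ℤ) {β} k {α m m₀ c c₀ n d} {x y : ℕ → ℤ → ℤ} .{{_ : NonZero m}} →
    Coprime m (p ∸ 1) → Coprime m p → p ∤ ∣ n ∣ → p ∤ ∣ d ∣ →
    Leading pp (suc (k + β)) (λ e t → G (x e t)) m c → Leading pp (suc (k + β)) (λ e t → G (y e t)) m₀ c₀ →
    (∀ E → ∃₂ λ e e₀ → E ≤ e × E ≤ e₀ × (c + e * m) + β ≡ (c₀ + e₀ * m₀) + α) →
    Approximation p G (P ℤ.^ α ℤ.* n) (P ℤ.^ β ℤ.* d) k
  approximate G {β} k {m = m} {m₀} {c} {c₀} {n} {d} {x} {y} m⊥p-1 m⊥p p∤n p∤d L M balance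
    with balance (L.threshold ℕ.⊔ M.threshold)
    where
    module L = Leading L
    module M = Leading M
  ... | e , e₀ , E≤e , E≤e₀ , A+β≡B+α = conclude
    (M.expansion e₀ 1ℤ (ℕ.m⊔n≤o⇒n≤o L.threshold M.threshold E≤e₀))
    where
    module L = Leading L
    module M = Leading M
    K = suc (k + β)
    -- The successor in K matters here: K is positive even for k + β = 0, so the error term cannot
    -- destroy the unit.
    unit-shift : ∀ v → p ∤ ∣ M.coefficient ℤ.+ P ℤ.^ K ℤ.* v ∣
    unit-shift v = ≈-∤ {b = M.coefficient}
      (by (P ℤ.^ (k + β) ℤ.* v) (cong (ℤ._+_ M.coefficient) (ℤ.*-assoc P (P ℤ.^ (k + β)) v))) M.unit
    factor₁ : ∀ b s k h v → s ≡ 1ℤ → b ℤ.* (s ℤ.* h) ℤ.+ b ℤ.* k ℤ.* v ≡ b ℤ.* (h ℤ.+ k ℤ.* v)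
    factor₁ b _ k h v refl = identity b k h v
      where
      identity : ∀ b k h v → b ℤ.* (1ℤ ℤ.* h) ℤ.+ b ℤ.* k ℤ.* v ≡ b ℤ.* (h ℤ.+ k ℤ.* v)
      identity = solve-∀
    factor : ∀ b h k v → b ℤ.* h ℤ.+ b ℤ.* k ℤ.* v ≡ b ℤ.* (h ℤ.+ k ℤ.* v)
    factor = solve-∀
    absorb : ∀ s h q u d Z → s ℤ.* (h ℤ.* d) ≈ Z [ q ] → (s ℤ.* h ℤ.+ q ℤ.* u) ℤ.* d ≈ Z [ q ]
    absorb s h q u d Z = ≈-trans (by (u ℤ.* d) (identity s h q u d))
      where
      identity : ∀ s h q u d → (s ℤ.* h ℤ.+ q ℤ.* u) ℤ.* d ≡ s ℤ.* (h ℤ.* d) ℤ.+ q ℤ.* (u ℤ.* d)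
      identity = solve-∀
    conclude : G (y e₀ 1ℤ) ≈ P ℤ.^ (c₀ + e₀ * m₀) ℤ.* (1ℤ ℤ.^ m₀ ℤ.* M.coefficient) [ P ℤ.^ (c₀ + e₀ * m₀) ℤ.* P ℤ.^ K ] → _
    conclude (by v Gy≡)
      -- The denominator is expanded first, because its error v enters the residue that t has to
      -- hit. The error u of the numerator depends on t, but it vanishes modulo p^K.
      with power-residue pp m⊥p-1 m⊥p K (L.coefficient ℤ.* d) (n ℤ.* (M.coefficient ℤ.+ P ℤ.^ K ℤ.* v))
        (∤-* pp L.coefficient d L.unit p∤d) (∤-* pp n _ p∤n (unit-shift v))
    ... | t , t^m≈ with L.expansion e t (ℕ.m⊔n≤o⇒m≤o L.threshold M.threshold E≤e)
    ...   | by u Gx≡ = approximate-units G (x e t) (y e₀ 1ℤ) {A = c + e * m} {c₀ + e₀ * m₀} k (unit-shift v) p∤d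
        (trans Gx≡ (factor (P ℤ.^ (c + e * m)) _ (P ℤ.^ K) u))
        (trans Gy≡ (factor₁ (P ℤ.^ (c₀ + e₀ * m₀)) _ (P ℤ.^ K) M.coefficient v (ℤ.^-zeroˡ m₀)))
        A+β≡B+α
        (≈-weaken {m = P} (absorb (t ℤ.^ m) L.coefficient (P ℤ.^ K) u d _ t^m≈))

-- The common form of f and g₂ and its behaviour near the roots

module _ (p q₁ q₂ q₃ #C a #D b #E : ℕ) where
  -- The multiplicities in g₂ collect the linear forms into three blocks; f is the
  -- case y = 1 with #C = #D = #E = 0.
  block₁₂ block₁₃ block₂₃ form : ℤ → ℤ → ℤ
  block₁₂ x y = x ℤ.* ∏ (λ j → + (p ^ suc j) ℤ.* x ℤ.+ y) #C
  block₁₃ x y = ∏ (λ j → x ℤ.+ + (p ^ suc j) ℤ.* y) q₁ ℤ.* ∏ (λ j → + (p ^ (a + j)) ℤ.* x ℤ.+ y) #D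
  block₂₃ x y = (x ℤ.+ + (p ^ (q₁ + 1)) ℤ.* y) ℤ.* ∏ (λ j → + (p ^ (b + j)) ℤ.* x ℤ.+ y) #E
  form x y = block₁₂ x y ℤ.^ (q₁ * q₂) ℤ.* block₁₃ x y ℤ.^ (q₁ * q₃) ℤ.* block₂₃ x y ℤ.^ (q₂ * q₃)

module _ {p} (pp : Prime p) (q₁ q₂ q₃ #C a #D b #E K : ℕ) where
  private
    P = + p

    near : ℤ → ℕ → ℤ → ℤ
    near r e t = r ℤ.+ P ℤ.^ e ℤ.* t

    -- The centre is written as p r so that p^s x + 1 is congruent to 1 modulo p there for every s,
    -- including s = 0.
    leading-unit-factor : ∀ r s → Leading pp K (λ e t → + (p ^ s) ℤ.* near (P ℤ.* r) e t ℤ.+ 1ℤ) 0 0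
    leading-unit-factor r s = leading-linear pp K 0 (1ℤ ℤ.+ P ℤ.* (+ (p ^ s) ℤ.* r)) (+ (p ^ s)) (≈-∤ {b = 1ℤ} (by (+ (p ^ s) ℤ.* r) refl) (∤1 pp))
      λ e t → identity (+ (p ^ s)) P r (P ℤ.^ e ℤ.* t)
      where
      identity : ∀ s p r x → s ℤ.* (p ℤ.* r ℤ.+ x) ℤ.+ 1ℤ ≡ 1ℤ ℤ.* (1ℤ ℤ.+ p ℤ.* (s ℤ.* r)) ℤ.+ s ℤ.* x
      identity = solve-∀

    leading-nonroot : ∀ r s c h → p ∤ ∣ h ∣ → r ℤ.+ s ≡ P ℤ.^ c ℤ.* h → Leading pp K (λ e t → near r e t ℤ.+ s ℤ.* 1ℤ) 0 c
    leading-nonroot r s c h p∤h eq = leading-linear pp K c h 1ℤ p∤h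
      λ e t → trans (identity r s (P ℤ.^ e ℤ.* t)) (cong (ℤ._+ 1ℤ ℤ.* (P ℤ.^ e ℤ.* t)) eq)
      where
      identity : ∀ r s x → r ℤ.+ x ℤ.+ s ℤ.* 1ℤ ≡ r ℤ.+ s ℤ.+ 1ℤ ℤ.* x
      identity = solve-∀

    leading-units : ∀ r (s : ℕ → ℕ) n → Leading pp K (λ e t → ∏ (λ j → + (p ^ s j) ℤ.* near (P ℤ.* r) e t ℤ.+ 1ℤ) n) 0 0
    leading-units r s n = leading-∏-units pp K {λ j e t → + (p ^ s j) ℤ.* near (P ℤ.* r) e t ℤ.+ 1ℤ} n λ j → leading-unit-factor r (s j)

    leading-*units : ∀ {z m c} r (s : ℕ → ℕ) n → Leading pp K z m c →
      Leading pp K (λ e t → z e t ℤ.* ∏ (λ j → + (p ^ s j) ℤ.* near (P ℤ.* r) e t ℤ.+ 1ℤ) n) m c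
    leading-*units {z} r s n L = leading-cast pp K (ℕ.+-identityʳ _) (ℕ.+-identityʳ _)
      (leading-* pp K {y = z} {z = λ e t → ∏ (λ j → + (p ^ s j) ℤ.* near (P ℤ.* r) e t ℤ.+ 1ℤ) n} L (leading-units r s n))

    leading-product : ∀ {x y z k l m a b c} → Leading pp K x k a → Leading pp K y l b → Leading pp K z m c → ∀ u v w →
      Leading pp K (λ e t → x e t ℤ.^ u ℤ.* y e t ℤ.^ v ℤ.* z e t ℤ.^ w) (u * k + v * l + w * m) (u * a + v * b + w * c)
    leading-product {x} {y} {z} L M N u v w =
      leading-* pp K {y = λ e t → x e t ℤ.^ u ℤ.* y e t ℤ.^ v} {z = λ e t → z e t ℤ.^ w}
        (leading-* pp K {y = λ e t → x e t ℤ.^ u} {z = λ e t → y e t ℤ.^ v} (leading-^ pp K {z = x} L u) (leading-^ pp K {z = y} M v))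
        (leading-^ pp K {z = z} N w)

    leading-form : ∀ r {k l m c₁ c₂ c₃} → Leading pp K (near (P ℤ.* r)) k c₁ →
      Leading pp K (λ e t → ∏ (λ j → near (P ℤ.* r) e t ℤ.+ + (p ^ suc j) ℤ.* 1ℤ) q₁) l c₂ →
      Leading pp K (λ e t → near (P ℤ.* r) e t ℤ.+ + (p ^ (q₁ + 1)) ℤ.* 1ℤ) m c₃ →
      Leading pp K (λ e t → form p q₁ q₂ q₃ #C a #D b #E (near (P ℤ.* r) e t) 1ℤ)
        (q₁ * q₂ * k + q₁ * q₃ * l + q₂ * q₃ * m) (q₁ * q₂ * c₁ + q₁ * q₃ * c₂ + q₂ * q₃ * c₃)
    leading-form r X A B = leading-product
      {x = λ e t → block₁₂ p q₁ q₂ q₃ #C a #D b #E (near (P ℤ.* r) e t) 1ℤ}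
      {y = λ e t → block₁₃ p q₁ q₂ q₃ #C a #D b #E (near (P ℤ.* r) e t) 1ℤ}
      {z = λ e t → block₂₃ p q₁ q₂ q₃ #C a #D b #E (near (P ℤ.* r) e t) 1ℤ}
      (leading-*units {near (P ℤ.* r)} r suc #C X)
      (leading-*units {λ e t → ∏ (λ j → near (P ℤ.* r) e t ℤ.+ + (p ^ suc j) ℤ.* 1ℤ) q₁} r (_+_ a) #D A)
      (leading-*units {λ e t → near (P ℤ.* r) e t ℤ.+ + (p ^ (q₁ + 1)) ℤ.* 1ℤ} r (_+_ b) #E B)
      (q₁ * q₂) (q₁ * q₃) (q₂ * q₃)

  -- At 0 the factor x + p^(q₁+1) contributes q₁ + 1 with exponent q₂q₃, the only part of the offset
  -- that is visible modulo q₁.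
  leading-at-0 : ∃ λ c → Leading pp K (λ e t → form p q₁ q₂ q₃ #C a #D b #E (near (P ℤ.* 0ℤ) e t) 1ℤ)
    (q₁ * q₂) (q₁ * q₃ * c + q₂ * q₃ * suc q₁)
  leading-at-0 = cA , leading-cast pp K
    (exponents (q₁ * q₂) (q₁ * q₃) (q₂ * q₃)) (valuations (q₁ * q₂) (q₁ * q₃) (q₂ * q₃) cA q₁)
    (leading-form 0ℤ root A B)
    where
    root : Leading pp K (near (P ℤ.* 0ℤ)) 1 0
    root = leading-root pp K λ e t → identity P (P ℤ.^ e ℤ.* t)
      where
      identity : ∀ p x → p ℤ.* 0ℤ ℤ.+ x ≡ x
      identity = solve-∀
    shift : ∀ n → P ℤ.* 0ℤ ℤ.+ + (p ^ n) ≡ P ℤ.^ n ℤ.* 1ℤ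
    shift n = trans (identity P (+ (p ^ n))) (cong (ℤ._* 1ℤ) (pos-^ p n))
      where
      identity : ∀ p x → p ℤ.* 0ℤ ℤ.+ x ≡ x ℤ.* 1ℤ
      identity = solve-∀
    A-all = leading-∏-nonroots pp K {λ j e t → near (P ℤ.* 0ℤ) e t ℤ.+ + (p ^ suc j) ℤ.* 1ℤ} q₁
      λ j → suc j , leading-nonroot (P ℤ.* 0ℤ) (+ (p ^ suc j)) (suc j) 1ℤ (∤1 pp) (shift (suc j))
    cA = proj₁ A-all
    A = proj₂ A-all
    B : Leading pp K (λ e t → near (P ℤ.* 0ℤ) e t ℤ.+ + (p ^ (q₁ + 1)) ℤ.* 1ℤ) 0 (q₁ + 1)
    B = leading-nonroot (P ℤ.* 0ℤ) (+ (p ^ (q₁ + 1))) (q₁ + 1) 1ℤ (∤1 pp) (shift (q₁ + 1))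
    exponents : ∀ u v w → u * 1 + v * 0 + w * 0 ≡ u
    exponents = ℕ.solve-∀
    valuations : ∀ u v w c q → u * 0 + v * c + w * (q + 1) ≡ v * c + w * suc q
    valuations = ℕ.solve-∀

  -- The centre is -p^(i+1). There x and x + p^(q₁+1) both have valuation i + 1; the first enters
  -- with exponent q₁q₂, so modulo q₁ the offset is q₂q₃ (i + 1).
  leading-at-root : ∀ {i} → i < q₁ → ∃ λ c →
    Leading pp K (λ e t → form p q₁ q₂ q₃ #C a #D b #E (near (P ℤ.* ℤ.- + (p ^ i)) e t) 1ℤ)
      (q₁ * q₃) (q₁ * q₂ * suc i + q₁ * q₃ * c + q₂ * q₃ * suc i)
  leading-at-root {i} i<q₁ = cA , leading-cast pp K
    (exponents (q₁ * q₂) (q₁ * q₃) (q₂ * q₃)) (valuations (q₁ * q₂) (q₁ * q₃) (q₂ * q₃) cA i)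
    (leading-form r X A B)
    where
    r = ℤ.- + (p ^ i)
    1<p : 1 < p
    1<p = ℕ.nonTrivial⇒n>1 p {{prime⇒nonTrivial pp}}
    factorʳ : ∀ n → P ℤ.* r ℤ.+ + (p ^ n) ≡ P ℤ.^ n ℤ.- P ℤ.^ suc i
    factorʳ n = trans (cong₂ (λ x y → P ℤ.* ℤ.- x ℤ.+ y) (pos-^ p i) (pos-^ p n)) (identity P (P ℤ.^ i) (P ℤ.^ n))
      where
      identity : ∀ p x y → p ℤ.* ℤ.- x ℤ.+ y ≡ y ℤ.- p ℤ.* x
      identity = solve-∀
    X : Leading pp K (near (P ℤ.* r)) 0 (suc i)
    X = leading-linear pp K (suc i) (ℤ.- 1ℤ) 1ℤ (∤1 pp)
      λ e t → trans (cong (λ x → P ℤ.* ℤ.- x ℤ.+ P ℤ.^ e ℤ.* t) (pos-^ p i)) (identity P (P ℤ.^ i) (P ℤ.^ e ℤ.* t))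
      where
      identity : ∀ p x y → p ℤ.* ℤ.- x ℤ.+ y ≡ p ℤ.* x ℤ.* ℤ.- 1ℤ ℤ.+ 1ℤ ℤ.* y
      identity = solve-∀
    root : Leading pp K (λ e t → near (P ℤ.* r) e t ℤ.+ + (p ^ suc i) ℤ.* 1ℤ) 1 0
    root = leading-root pp K λ e t → trans (cong (λ y → P ℤ.* r ℤ.+ P ℤ.^ e ℤ.* t ℤ.+ y ℤ.* 1ℤ) (ℤ.pos-* p (p ^ i)))
      (identity P (+ (p ^ i)) (P ℤ.^ e ℤ.* t))
      where
      identity : ∀ p x y → p ℤ.* ℤ.- x ℤ.+ y ℤ.+ p ℤ.* x ℤ.* 1ℤ ≡ y
      identity = solve-∀
    nonroot : ∀ j → j ≢ i → ∃ λ c → Leading pp K (λ e t → near (P ℤ.* r) e t ℤ.+ + (p ^ suc j) ℤ.* 1ℤ) 0 c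
    nonroot j j≢i = from-split (split pp (P ℤ.* r ℤ.+ + (p ^ suc j)) nonzero)
      where
      nonzero : P ℤ.* r ℤ.+ + (p ^ suc j) ≢ 0ℤ
      nonzero eq = j≢i (ℕ.suc-injective (^-injectiveʳ (ℤ.+-injective
        (trans (pos-^ p (suc j)) (trans (ℤ.i-j≡0⇒i≡j (P ℤ.^ suc j) (P ℤ.^ suc i) (trans (sym (factorʳ (suc j))) eq)) (sym (pos-^ p (suc i))))))))
        where
        ^-injectiveʳ : ∀ {m n} → p ^ m ≡ p ^ n → m ≡ n
        ^-injectiveʳ {m} {n} eq with ℕ.<-cmp m n
        ... | tri< m<n _ _ = ⊥-elim (ℕ.<⇒≢ (ℕ.^-monoʳ-< p 1<p m<n) eq)
        ... | tri≈ _ m≡n _ = m≡n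
        ... | tri> _ _ n<m = ⊥-elim (ℕ.<⇒≢ (ℕ.^-monoʳ-< p 1<p n<m) (sym eq))
      from-split : ∃₂ (λ c h → P ℤ.* r ℤ.+ + (p ^ suc j) ≡ P ℤ.^ c ℤ.* h × p ∤ ∣ h ∣) →
        ∃ λ c → Leading pp K (λ e t → near (P ℤ.* r) e t ℤ.+ + (p ^ suc j) ℤ.* 1ℤ) 0 c
      from-split (c , h , eq , p∤h) = c , leading-nonroot (P ℤ.* r) (+ (p ^ suc j)) c h p∤h eq
    A-all = leading-∏-root pp K {λ j e t → near (P ℤ.* r) e t ℤ.+ + (p ^ suc j) ℤ.* 1ℤ} i<q₁ root nonroot
    cA = proj₁ A-all
    A = proj₂ A-all
    k = q₁ ∸ suc i
    -- Here p^(q₁+1) - p^(i+1) = p^(i+1) (p^(q₁-i) - 1), and q₁ - i = k + 1 is positive because i <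
    -- q₁, so the cofactor is -1 modulo p.
    B : Leading pp K (λ e t → near (P ℤ.* r) e t ℤ.+ + (p ^ (q₁ + 1)) ℤ.* 1ℤ) 0 (suc i)
    B = leading-nonroot (P ℤ.* r) (+ (p ^ (q₁ + 1))) (suc i) (ℤ.- 1ℤ ℤ.+ P ℤ.* P ℤ.^ k)
      (≈-∤ {b = ℤ.- 1ℤ} (by (P ℤ.^ k) refl) (∤1 pp))
      (trans (factorʳ (q₁ + 1)) (trans (cong (λ y → y ℤ.- P ℤ.^ suc i) P^[q₁+1]≡) (identity P (P ℤ.^ suc i) (P ℤ.^ k))))
      where
      P^[q₁+1]≡ : P ℤ.^ (q₁ + 1) ≡ P ℤ.* (P ℤ.^ suc i ℤ.* P ℤ.^ k)
      P^[q₁+1]≡ = trans (cong (P ℤ.^_) (trans (ℕ.+-comm q₁ 1) (cong suc (sym (ℕ.m+[n∸m]≡n i<q₁)))))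
        (cong (ℤ._*_ P) (ℤ.^-distribˡ-+-* P (suc i) k))
      identity : ∀ p x y → p ℤ.* (x ℤ.* y) ℤ.- x ≡ x ℤ.* (ℤ.- 1ℤ ℤ.+ p ℤ.* y)
      identity = solve-∀
    exponents : ∀ u v w → u * 0 + v * 1 + w * 0 ≡ v
    exponents = ℕ.solve-∀
    valuations : ∀ u v w c i → u * suc i + v * c + w * suc i ≡ u * suc i + v * c + w * suc i
    valuations = ℕ.solve-∀

-- The index i makes both sides agree modulo q₁.
balance-valuations : ∀ {q₁ q₂ q₃} .{{_ : NonZero q₁}} .{{_ : NonZero q₂}} .{{_ : NonZero q₃}} →
  Coprime (q₂ * q₃) q₁ → Coprime q₃ q₂ → ∀ α β → ∃ λ i → i < q₁ × (∀ c c₀ E → ∃₂ λ e e₀ → E ≤ e × E ≤ e₀ ×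
    ((q₁ * q₂ * suc i + q₁ * q₃ * c + q₂ * q₃ * suc i) + e * (q₁ * q₃)) + β
      ≡ ((q₁ * q₃ * c₀ + q₂ * q₃ * suc q₁) + e₀ * (q₁ * q₂)) + α)
-- Modulo q₁ the required equation reads w i + β ≡ α, as the offsets w (i + 1) and w (q₁ + 1) both
-- contain one extra w. It is solved by some natural number x, of which only the remainder modulo q₁
-- is used.
balance-valuations {q₁} {q₂} {q₃} q₂q₃⊥q₁ q₃⊥q₂ α β with coprime-balance {{ℕ.m*n≢0 q₂ q₃}} q₂q₃⊥q₁ β α 0
... | x , y , _ , _ , xw+β≡ = i , m%n<n x q₁ , balance
  where
  i = x % q₁
  h = x / q₁
  w = q₂ * q₃
  balance : ∀ c c₀ E → ∃₂ λ e e₀ → E ≤ e × E ≤ e₀ ×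
    ((q₁ * q₂ * suc i + q₁ * q₃ * c + w * suc i) + e * (q₁ * q₃)) + β
      ≡ ((q₁ * q₃ * c₀ + w * suc q₁) + e₀ * (q₁ * q₂)) + α
  -- Divided by q₁, the equation relates a multiple of q₃ to a multiple of q₂. The term y comes from
  -- x w + β = y q₁ + α, and h w compensates for the passage from x = i + h q₁ to i.
  balance c c₀ E with coprime-balance q₃⊥q₂ (q₂ * suc i + q₃ * c + y) (q₃ * c₀ + w + h * w) E
  ... | e , e₀ , E≤e , E≤e₀ , eq = e , e₀ , E≤e , E≤e₀ , ℕ.+-cancelʳ-≡ (q₁ * h * w) _ _ (begin
    ((q₁ * q₂ * suc i + q₁ * q₃ * c + w * suc i) + e * (q₁ * q₃)) + β + q₁ * h * w  ≡⟨ expand q₁ q₂ q₃ w i c e β h ⟩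
    q₁ * (e * q₃ + (q₂ * suc i + q₃ * c)) + w + ((i + h * q₁) * w + β)              ≡⟨ cong (λ z → q₁ * (e * q₃ + (q₂ * suc i + q₃ * c)) + w + (z * w + β)) (sym (m≡m%n+[m/n]*n x q₁)) ⟩
    q₁ * (e * q₃ + (q₂ * suc i + q₃ * c)) + w + (x * w + β)                         ≡⟨ cong (_+_ (q₁ * (e * q₃ + (q₂ * suc i + q₃ * c)) + w)) xw+β≡ ⟩
    q₁ * (e * q₃ + (q₂ * suc i + q₃ * c)) + w + (y * q₁ + α)                        ≡⟨ collect q₁ q₂ q₃ w i c e α y ⟩
    q₁ * (e * q₃ + (q₂ * suc i + q₃ * c + y)) + w + α                               ≡⟨ cong (λ z → q₁ * z + w + α) eq ⟩
    q₁ * (e₀ * q₂ + (q₃ * c₀ + w + h * w)) + w + α                                  ≡⟨ restore q₁ q₂ q₃ w c₀ e₀ α h ⟩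
    ((q₁ * q₃ * c₀ + w * suc q₁) + e₀ * (q₁ * q₂)) + α + q₁ * h * w                 ∎)
    where
    open ≡-Reasoning
    expand : ∀ q₁ q₂ q₃ w i c e β h → ((q₁ * q₂ * suc i + q₁ * q₃ * c + w * suc i) + e * (q₁ * q₃)) + β + q₁ * h * w
      ≡ q₁ * (e * q₃ + (q₂ * suc i + q₃ * c)) + w + ((i + h * q₁) * w + β)
    expand = ℕ.solve-∀
    collect : ∀ q₁ q₂ q₃ w i c e α y → q₁ * (e * q₃ + (q₂ * suc i + q₃ * c)) + w + (y * q₁ + α)
      ≡ q₁ * (e * q₃ + (q₂ * suc i + q₃ * c + y)) + w + α
    collect = ℕ.solve-∀
    restore : ∀ q₁ q₂ q₃ w c₀ e₀ α h → q₁ * (e₀ * q₂ + (q₃ * c₀ + w + h * w)) + w + α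
      ≡ ((q₁ * q₃ * c₀ + w * suc q₁) + e₀ * (q₁ * q₂)) + α + q₁ * h * w
    restore = ℕ.solve-∀

form-approximation : ∀ {p q₁ q₂ q₃} → Prime p → Prime q₁ → Prime q₂ → Prime q₃ → q₁ < q₂ → q₂ < q₃ →
  Coprime (q₁ * q₂ * q₃) (p * (p ∸ 1)) → ∀ #C a #D b #E n d k → n ≢ 0ℤ → d ≢ 0ℤ →
  Approximation p (λ x → form p q₁ q₂ q₃ #C a #D b #E x 1ℤ) n d k
form-approximation {p} {q₁} {q₂} {q₃} pp pq₁ pq₂ pq₃ q₁<q₂ q₂<q₃ cop #C a #D b #E n d k n≢0 d≢0 =
  from-split (split pp n n≢0) (split pp d d≢0)
  where
  P = + p
  G : ℤ → ℤ
  G x = form p q₁ q₂ q₃ #C a #D b #E x 1ℤ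
  q₁q₃⇒ : ∀ {r} → r ∣ q₁ * q₃ → r ∣ q₁ * q₂ * q₃
  q₁q₃⇒ {r} r∣ = subst (r ∣_) (identity q₁ q₂ q₃) (ℕ.∣n⇒∣m*n q₂ r∣)
    where
    identity : ∀ x y z → y * (x * z) ≡ x * y * z
    identity = ℕ.solve-∀
  instance
    q₁≢0 = prime⇒nonZero pq₁
    q₂≢0 = prime⇒nonZero pq₂
    q₃≢0 = prime⇒nonZero pq₃
    q₁q₃≢0 = ℕ.m*n≢0 q₁ q₃
  q₂q₃⊥q₁ : Coprime (q₂ * q₃) q₁
  q₂q₃⊥q₁ = Coprime.sym (coprime-*ʳ (Coprime.sym (prime⇒coprime pq₂ q₁<q₂))
    (Coprime.sym (prime⇒coprime pq₃ (ℕ.<-trans q₁<q₂ q₂<q₃))))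
  at-units : ∀ α n′ β d′ → p ∤ ∣ n′ ∣ → p ∤ ∣ d′ ∣ → Approximation p G (P ℤ.^ α ℤ.* n′) (P ℤ.^ β ℤ.* d′) k
  at-units α n′ β d′ p∤n′ p∤d′ = approximate pp G k {d = d′}
    (λ (∣q , ∣p-1) → cop (q₁q₃⇒ ∣q , ℕ.∣n⇒∣m*n p ∣p-1)) (λ (∣q , ∣p) → cop (q₁q₃⇒ ∣q , ℕ.∣m⇒∣m*n (p ∸ 1) ∣p))
    p∤n′ p∤d′ (proj₂ numerator) (proj₂ denominator) (proj₂ (proj₂ balanced) (proj₁ numerator) (proj₁ denominator))
    where
    -- The index i depends on α and β only. It has to be known before the expansion at its root,
    -- whose offset is in turn needed to find the exponents.
    balanced = balance-valuations q₂q₃⊥q₁ (prime⇒coprime pq₃ q₂<q₃) α β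
    numerator = leading-at-root pp q₁ q₂ q₃ #C a #D b #E (suc (k + β)) (proj₁ (proj₂ balanced))
    denominator = leading-at-0 pp q₁ q₂ q₃ #C a #D b #E (suc (k + β))
  from-split : ∃₂ (λ α n′ → n ≡ P ℤ.^ α ℤ.* n′ × p ∤ ∣ n′ ∣) → ∃₂ (λ β d′ → d ≡ P ℤ.^ β ℤ.* d′ × p ∤ ∣ d′ ∣) → Approximation p G n d k
  from-split (α , n′ , n≡ , p∤n′) (β , d′ , d≡ , p∤d′) =
    subst₂ (λ x y → Approximation p G x y k) (sym n≡) (sym d≡) (at-units α n′ β d′ p∤n′ p∤d′)

-- Density in ℚ_p

fromℤ-/1 : ∀ z → z ℚ./ 1 ≡ fromℤ z
fromℤ-/1 z = ℚ.↥p/↧p≡p (fromℤ z)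

fromℤ-* : ∀ a b → fromℤ (a ℤ.* b) ≡ fromℤ a ℚ.* fromℤ b
fromℤ-* a b = sym (fromℤ-/1 (a ℤ.* b))

fromℤ-+ : ∀ a b → fromℤ (a ℤ.+ b) ≡ fromℤ a ℚ.+ fromℤ b
fromℤ-+ a b = trans (sym (fromℤ-/1 (a ℤ.+ b)))
  (cong (ℚ._/ 1) (cong₂ ℤ._+_ (sym (ℤ.*-identityʳ a)) (sym (ℤ.*-identityʳ b))))

fromℤ-neg : ∀ a → fromℤ (ℤ.- a) ≡ ℚ.- fromℤ a
fromℤ-neg (+ zero)    = refl
fromℤ-neg (+ (suc n)) = refl
fromℤ-neg -[1+ n ]    = refl

fromℤ-injective : ∀ {a b} → fromℤ a ≡ fromℤ b → a ≡ b
fromℤ-injective = cong ℚ.numerator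

fromℤ-- : ∀ a b → fromℤ (a ℤ.- b) ≡ fromℤ a ℚ.- fromℤ b
fromℤ-- a b = trans (fromℤ-+ a (ℤ.- b)) (cong (ℚ._+_ (fromℤ a)) (fromℤ-neg b))

*-denominator : ∀ r → r ℚ.* fromℤ (ℚ.↧ r) ≡ fromℤ (ℚ.↥ r)
*-denominator r@record{} = ℚ.toℚᵘ-injective (ℚᵘ.≃-trans (ℚ.toℚᵘ-homo-* r (fromℤ (ℚ.↧ r))) (ℚᵘ.*≡* (identity (ℚ.↥ r) (ℚ.↧ r))))
  where
  identity : ∀ n d → n ℤ.* d ℤ.* 1ℤ ≡ n ℤ.* (d ℤ.* 1ℤ)
  identity = solve-∀

*-cancelʳ-fromℤ : ∀ {a b} z → z ≢ 0ℤ → a ℚ.* fromℤ z ≡ b ℚ.* fromℤ z → a ≡ b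
*-cancelʳ-fromℤ {a} {b} z z≢0 eq = begin
  a                                          ≡⟨ undo a ⟩
  a ℚ.* fromℤ z ℚ.* ℚ.1/ fromℤ z             ≡⟨ cong (ℚ._* ℚ.1/ fromℤ z) eq ⟩
  b ℚ.* fromℤ z ℚ.* ℚ.1/ fromℤ z             ≡⟨ undo b ⟨
  b                                          ∎
  where
  open ≡-Reasoning
  instance _ = ℤ.≢-nonZero z≢0
  undo : ∀ c → c ≡ c ℚ.* fromℤ z ℚ.* ℚ.1/ fromℤ z
  undo c = sym (trans (ℚ.*-assoc c (fromℤ z) (ℚ.1/ fromℤ z)) (trans (cong (ℚ._*_ c) (ℚ.*-inverseʳ (fromℤ z))) (ℚ.*-identityʳ c)))

÷-*-fromℤ : ∀ c z (z≢0 : z ≢ 0ℤ) → ℚ._÷_ c (fromℤ z) {{ℤ.≢-nonZero z≢0}} ℚ.* fromℤ z ≡ c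
÷-*-fromℤ c z z≢0 = trans (ℚ.*-assoc c (ℚ.1/ fromℤ z) (fromℤ z)) (trans (cong (ℚ._*_ c) (ℚ.*-inverseˡ (fromℤ z))) (ℚ.*-identityʳ c))
  where instance _ = ℤ.≢-nonZero z≢0

-- This links the distance in `Within` to equations between integers; it is read from left to right
-- for density and from right to left for non-density.
distance-of-ratios : ∀ {r a n d X Y} w → r ℚ.* fromℤ d ≡ fromℤ n → a ℚ.* fromℤ Y ≡ fromℤ X →
  (r ℚ.- a) ℚ.* fromℤ w ℚ.* fromℤ (d ℤ.* Y) ≡ fromℤ ((n ℤ.* Y ℤ.- X ℤ.* d) ℤ.* w)
distance-of-ratios {r} {a} {n} {d} {X} {Y} w rd≡n aY≡X = begin
  (r ℚ.- a) ℚ.* fromℤ w ℚ.* fromℤ (d ℤ.* Y)                    ≡⟨ cong (ℚ._*_ ((r ℚ.- a) ℚ.* fromℤ w)) (fromℤ-* d Y) ⟩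
  (r ℚ.- a) ℚ.* fromℤ w ℚ.* (fromℤ d ℚ.* fromℤ Y)              ≡⟨ expand r a (fromℤ w) (fromℤ d) (fromℤ Y) ⟩
  (r ℚ.* fromℤ d ℚ.* fromℤ Y ℚ.- a ℚ.* fromℤ Y ℚ.* fromℤ d) ℚ.* fromℤ w
    ≡⟨ cong₂ (λ s t → (s ℚ.* fromℤ Y ℚ.- t ℚ.* fromℤ d) ℚ.* fromℤ w) rd≡n aY≡X ⟩
  (fromℤ n ℚ.* fromℤ Y ℚ.- fromℤ X ℚ.* fromℤ d) ℚ.* fromℤ w    ≡⟨ cong₂ (λ s t → (s ℚ.- t) ℚ.* fromℤ w) (fromℤ-* n Y) (fromℤ-* X d) ⟨
  (fromℤ (n ℤ.* Y) ℚ.- fromℤ (X ℤ.* d)) ℚ.* fromℤ w            ≡⟨ cong (ℚ._* fromℤ w) (fromℤ-- (n ℤ.* Y) (X ℤ.* d)) ⟨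
  fromℤ (n ℤ.* Y ℤ.- X ℤ.* d) ℚ.* fromℤ w                      ≡⟨ fromℤ-* (n ℤ.* Y ℤ.- X ℤ.* d) w ⟨
  fromℤ ((n ℤ.* Y ℤ.- X ℤ.* d) ℤ.* w)                          ∎
  where
  open ≡-Reasoning
  module S = ℚ.+-*-Solver
  expand : ∀ r a w d Y → (r ℚ.- a) ℚ.* w ℚ.* (d ℚ.* Y) ≡ (r ℚ.* d ℚ.* Y ℚ.- a ℚ.* Y ℚ.* d) ℚ.* w
  expand = S.solve 5 (λ r a w d Y → (r S.:- a) S.:* w S.:* (d S.:* Y) S.:= (r S.:* d S.:* Y S.:- a S.:* Y S.:* d) S.:* w) refl

-- `Within` asks for a natural number w, so a negative w hands its sign over to u.
within-fromℤ : ∀ {p} k r a w u → p ∤ ∣ w ∣ → (r ℚ.- a) ℚ.* fromℤ w ≡ fromℤ ((+ p) ℤ.^ k ℤ.* u) → Within p k r a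
within-fromℤ {p} k r a (+ n) u p∤w eq = u , n , p∤w , trans eq (cong (λ z → fromℤ (z ℤ.* u)) (sym (pos-^ p k)))
within-fromℤ {p} k r a -[1+ n ] u p∤w eq = ℤ.- u , suc n , p∤w , (begin
  (r ℚ.- a) ℚ.* fromℤ (ℤ.- -[1+ n ])      ≡⟨ cong (ℚ._*_ (r ℚ.- a)) (fromℤ-neg -[1+ n ]) ⟩
  (r ℚ.- a) ℚ.* ℚ.- fromℤ -[1+ n ]        ≡⟨ ℚ.neg-distribʳ-* (r ℚ.- a) (fromℤ -[1+ n ]) ⟨
  ℚ.- ((r ℚ.- a) ℚ.* fromℤ -[1+ n ])      ≡⟨ cong ℚ.-_ eq ⟩
  ℚ.- fromℤ ((+ p) ℤ.^ k ℤ.* u)           ≡⟨ fromℤ-neg _ ⟨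
  fromℤ (ℤ.- ((+ p) ℤ.^ k ℤ.* u))         ≡⟨ cong fromℤ (trans (ℤ.neg-distribʳ-* ((+ p) ℤ.^ k) u) (cong (ℤ._* (ℤ.- u)) (sym (pos-^ p k)))) ⟩
  fromℤ (+ (p ^ k) ℤ.* ℤ.- u)             ∎)
  where open ≡-Reasoning

within-trans : ∀ {p} k a b c → Prime p → Within p k a b → Within p k b c → Within p k a c
within-trans {p} k a b c pp (u , w , p∤w , eq) (v , x , p∤x , eq′) =
  within-fromℤ k a c (+ w ℤ.* + x) (u ℤ.* + x ℤ.+ v ℤ.* + w) (∤-* pp (+ w) (+ x) p∤w p∤x) (begin
  (a ℚ.- c) ℚ.* fromℤ (+ w ℤ.* + x)                                         ≡⟨ cong (ℚ._*_ (a ℚ.- c)) (fromℤ-* (+ w) (+ x)) ⟩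
  (a ℚ.- c) ℚ.* (fromℤ (+ w) ℚ.* fromℤ (+ x))                               ≡⟨ split-difference a b c (fromℤ (+ w)) (fromℤ (+ x)) ⟩
  (a ℚ.- b) ℚ.* fromℤ (+ w) ℚ.* fromℤ (+ x) ℚ.+ (b ℚ.- c) ℚ.* fromℤ (+ x) ℚ.* fromℤ (+ w)
    ≡⟨ cong₂ (λ s t → s ℚ.* fromℤ (+ x) ℚ.+ t ℚ.* fromℤ (+ w)) eq eq′ ⟩
  fromℤ (+ (p ^ k) ℤ.* u) ℚ.* fromℤ (+ x) ℚ.+ fromℤ (+ (p ^ k) ℤ.* v) ℚ.* fromℤ (+ w)
    ≡⟨ cong₂ ℚ._+_ (fromℤ-* (+ (p ^ k) ℤ.* u) (+ x)) (fromℤ-* (+ (p ^ k) ℤ.* v) (+ w)) ⟨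
  fromℤ (+ (p ^ k) ℤ.* u ℤ.* + x) ℚ.+ fromℤ (+ (p ^ k) ℤ.* v ℤ.* + w)
    ≡⟨ fromℤ-+ (+ (p ^ k) ℤ.* u ℤ.* + x) (+ (p ^ k) ℤ.* v ℤ.* + w) ⟨
  fromℤ (+ (p ^ k) ℤ.* u ℤ.* + x ℤ.+ + (p ^ k) ℤ.* v ℤ.* + w)
    ≡⟨ cong fromℤ (trans (collect (+ (p ^ k)) u v (+ w) (+ x)) (cong (ℤ._* (u ℤ.* + x ℤ.+ v ℤ.* + w)) (pos-^ p k))) ⟩
  fromℤ ((+ p) ℤ.^ k ℤ.* (u ℤ.* + x ℤ.+ v ℤ.* + w))                         ∎)
  where
  open ≡-Reasoning
  module S = ℚ.+-*-Solver
  split-difference : ∀ a b c w x → (a ℚ.- c) ℚ.* (w ℚ.* x) ≡ (a ℚ.- b) ℚ.* w ℚ.* x ℚ.+ (b ℚ.- c) ℚ.* x ℚ.* w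
  split-difference = S.solve 5 (λ a b c w x → (a S.:- c) S.:* (w S.:* x) S.:= (a S.:- b) S.:* w S.:* x S.:+ (b S.:- c) S.:* x S.:* w) refl
  collect : ∀ q u v w x → q ℤ.* u ℤ.* x ℤ.+ q ℤ.* v ℤ.* w ≡ q ℤ.* (u ℤ.* x ℤ.+ v ℤ.* w)
  collect = solve-∀

within-p^k : ∀ {p k r} → Prime p → r ≡ ℚ.0ℚ → Within p k r (fromℤ ((+ p) ℤ.^ k))
within-p^k {p} {k} pp refl = within-fromℤ k ℚ.0ℚ (fromℤ ((+ p) ℤ.^ k)) 1ℤ (ℤ.- 1ℤ) (∤1 pp) (begin
  (ℚ.0ℚ ℚ.- fromℤ q) ℚ.* fromℤ 1ℤ  ≡⟨ cong (ℚ._* fromℤ 1ℤ) (fromℤ-- 0ℤ q) ⟨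
  fromℤ (0ℤ ℤ.- q) ℚ.* fromℤ 1ℤ    ≡⟨ fromℤ-* (0ℤ ℤ.- q) 1ℤ ⟨
  fromℤ ((0ℤ ℤ.- q) ℤ.* 1ℤ)        ≡⟨ cong fromℤ (identity q) ⟩
  fromℤ (q ℤ.* ℤ.- 1ℤ)             ∎)
  where
  open ≡-Reasoning
  q = (+ p) ℤ.^ k
  identity : ∀ q → (0ℤ ℤ.- q) ℤ.* 1ℤ ≡ q ℤ.* ℤ.- 1ℤ
  identity = solve-∀

approximation-within : ∀ {p G n d} k r a → Prime p → d ≢ 0ℤ → (A : Approximation p G n d k) → (let open Approximation A) →
  r ℚ.* fromℤ d ≡ fromℤ n → a ℚ.* fromℤ (G y) ≡ fromℤ (G x) → Within p k r a
approximation-within {p} {G} {n} {d} k r a pp d≢0 A rd≡n aGy≡Gx =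
  within-fromℤ k r a w u p∤w (*-cancelʳ-fromℤ (d ℤ.* G y) (*-≢0 pp d (G y) d≢0 Gy≢0) (begin
    (r ℚ.- a) ℚ.* fromℤ w ℚ.* fromℤ (d ℤ.* G y)     ≡⟨ distance-of-ratios {r} {a} {n} {d} {G x} {G y} w rd≡n aGy≡Gx ⟩
    fromℤ ((n ℤ.* G y ℤ.- G x ℤ.* d) ℤ.* w)         ≡⟨ cong fromℤ close ⟩
    fromℤ ((+ p) ℤ.^ k ℤ.* u ℤ.* (d ℤ.* G y))       ≡⟨ fromℤ-* ((+ p) ℤ.^ k ℤ.* u) (d ℤ.* G y) ⟩
    fromℤ ((+ p) ℤ.^ k ℤ.* u) ℚ.* fromℤ (d ℤ.* G y) ∎))
  where
  open ≡-Reasoning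
  open Approximation A

module _ {p n} {h : Polynomial n} (pp : Prime p) (G : ℤ → ℤ) (point : ℤ → Vec ℤ n) (h≡G : ∀ x → ⟦ h ⟧ (point x) ≡ G x)
         (approx : ∀ n d k → n ≢ 0ℤ → d ≢ 0ℤ → Approximation p G n d k) where

  private
    near-ratio : ∀ k r n d → r ℚ.* fromℤ d ≡ fromℤ n → n ≢ 0ℤ → d ≢ 0ℤ → ∃ λ a → R h a × Within p k r a
    near-ratio k r n d rd≡n n≢0 d≢0 = a , (point A.x , point A.y , hy≢0 , refl) ,
      approximation-within k r a pp d≢0 (approx n d k n≢0 d≢0) rd≡n aGy≡Gx
      where
      module A = Approximation (approx n d k n≢0 d≢0)
      hy≢0 : ⟦ h ⟧ (point A.y) ≢ 0ℤ
      hy≢0 = subst (_≢ 0ℤ) (sym (h≡G A.y)) A.Gy≢0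
      a = ℚ._÷_ (fromℤ (⟦ h ⟧ (point A.x))) (fromℤ (⟦ h ⟧ (point A.y))) {{ℤ.≢-nonZero hy≢0}}
      aGy≡Gx : a ℚ.* fromℤ (G A.y) ≡ fromℤ (G A.x)
      aGy≡Gx = trans (cong (λ z → a ℚ.* fromℤ z) (sym (h≡G A.y)))
        (trans (÷-*-fromℤ (fromℤ (⟦ h ⟧ (point A.x))) (⟦ h ⟧ (point A.y)) hy≢0) (cong fromℤ (h≡G A.x)))

    -- 0 has no valuation to match, so pᵏ is approximated in its place.
    near-rational : ∀ k r → Dec (ℚ.↥ r ≡ 0ℤ) → ∃ λ a → R h a × Within p k r a
    near-rational k r (no ↥r≢0)  = near-ratio k r (ℚ.↥ r) (ℚ.↧ r) (*-denominator r) ↥r≢0 λ ()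
    near-rational k r (yes ↥r≡0) = via-p^k
      (near-ratio k p^k ((+ p) ℤ.^ k) 1ℤ (trans (sym (fromℤ-* ((+ p) ℤ.^ k) 1ℤ)) (cong fromℤ (ℤ.*-identityʳ _))) (P^≢0 pp k) λ ())
      where
      p^k = fromℤ ((+ p) ℤ.^ k)
      via-p^k : (∃ λ a → R h a × Within p k p^k a) → ∃ λ a → R h a × Within p k r a
      via-p^k (a , Ra , p^k≈a) = a , Ra , within-trans k r p^k a pp (within-p^k {k = k} pp (ℚ.↥p≡0⇒p≡0 r ↥r≡0)) p^k≈a

  -- It suffices to approximate one term of the Cauchy sequence, late enough for precision k: by the
  -- ultrametric inequality no precision is lost in passing to the later terms.
  dense : DenseIn p (R h)
  dense x k = close-to-x (near-rational k r (ℚ.↥ r ℤ.≟ 0ℤ))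
    where
    N = proj₁ (cauchy x k)
    r = seq x N
    close-to-x : (∃ λ a → R h a × Within p k r a) → ∃ λ a → R h a × Near p k x a
    close-to-x (a , Ra , r≈a) = a , Ra , N , λ n N≤n →
      within-trans k (seq x n) r a pp (proj₂ (cauchy x k) n N N≤n ℕ.≤-refl) r≈a

-- Valuations and non-density

record HasVal (q v : ℕ) (z : ℤ) : Set where
  constructor val
  field
    cofactor   : ℤ
    factorised : z ≡ (+ q) ℤ.^ v ℤ.* cofactor
    unit       : q ∤ ∣ cofactor ∣

module _ {q} (pq : Prime q) where
  private
    Q = + q
    instance
      q≢0 : NonZero q
      q≢0 = prime⇒nonZero pq

  ∤⇒val-0 : ∀ {z} → q ∤ ∣ z ∣ → HasVal q 0 z
  ∤⇒val-0 {z} q∤z = val z (sym (ℤ.*-identityˡ z)) q∤z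

  val-* : ∀ {a b x y} → HasVal q a x → HasVal q b y → HasVal q (a + b) (x ℤ.* y)
  val-* {a} {b} {x} {y} (val u x≡ q∤u) (val v y≡ q∤v) = val (u ℤ.* v)
    (trans (cong₂ ℤ._*_ x≡ y≡) (trans (shuffle (Q ℤ.^ a) u (Q ℤ.^ b) v) (cong (ℤ._* (u ℤ.* v)) (sym (ℤ.^-distribˡ-+-* Q a b)))))
    (∤-* pq u v q∤u q∤v)
    where
    shuffle : ∀ a u b v → a ℤ.* u ℤ.* (b ℤ.* v) ≡ a ℤ.* b ℤ.* (u ℤ.* v)
    shuffle = solve-∀

  val-^ : ∀ {a x} → HasVal q a x → ∀ n → HasVal q (n * a) (x ℤ.^ n)
  val-^ x zero    = ∤⇒val-0 (∤1 pq)
  val-^ x (suc n) = val-* x (val-^ x n)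

  val-unique : ∀ a b {x} → HasVal q a x → HasVal q b x → a ≡ b
  val-unique zero    zero    _ _ = refl
  val-unique zero    (suc b) (val u refl q∤u) (val v eq _) = ⊥-elim (q∤u (multiple⇒∣ {u = Q ℤ.^ b ℤ.* v}
    (trans (sym (ℤ.*-identityˡ u)) (trans eq (ℤ.*-assoc Q (Q ℤ.^ b) v)))))
  val-unique (suc a) zero    (val u refl _) (val v eq q∤v) = ⊥-elim (q∤v (multiple⇒∣ {u = Q ℤ.^ a ℤ.* u}
    (trans (sym (ℤ.*-identityˡ v)) (trans (sym eq) (ℤ.*-assoc Q (Q ℤ.^ a) u)))))
  val-unique (suc a) (suc b) (val u refl q∤u) (val v eq q∤v) = cong suc (val-unique a b (val u refl q∤u)
    (val v (ℤ.*-cancelˡ-≡ Q _ _ (trans (sym (ℤ.*-assoc Q (Q ℤ.^ a) u)) (trans eq (ℤ.*-assoc Q (Q ℤ.^ b) v)))) q∤v))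

  val-≢0 : ∀ {a x} → HasVal q a x → x ≢ 0ℤ
  val-≢0 {a} (val u refl q∤u) = *-≢0 pq (Q ℤ.^ a) u (P^≢0 pq a) (∤⇒≢0 pq {u} q∤u)

  -- The number q itself cannot be approximated within q⁻². A ratio X / Y that close satisfies X w =
  -- q Y (w - q u) with w and w - q u prime to q, so X has valuation exactly one more than Y, which
  -- the gap in T excludes.
  not-dense : ∀ {n} {h : Polynomial n} (T : ℕ → Set) → (∀ v → T v → ¬ T (suc v)) →
    (∀ y → ⟦ h ⟧ y ≢ 0ℤ → ∃ λ v → T v × HasVal q v (⟦ h ⟧ y)) → ¬ DenseIn q (R h)
  not-dense {n} {h} T T-gap valuation h-dense = from-value (h-dense const-q 2)
    where
    within-self : ∀ k r → Within q k r r
    within-self k r = within-fromℤ k r r 1ℤ 0ℤ (∤1 pq) (begin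
      (r ℚ.- r) ℚ.* fromℤ 1ℤ   ≡⟨ cong (ℚ._* fromℤ 1ℤ) (ℚ.+-inverseʳ r) ⟩
      ℚ.0ℚ ℚ.* fromℤ 1ℤ        ≡⟨ ℚ.*-zeroˡ (fromℤ 1ℤ) ⟩
      ℚ.0ℚ                     ≡⟨ cong fromℤ (sym (ℤ.*-zeroʳ (Q ℤ.^ k))) ⟩
      fromℤ (Q ℤ.^ k ℤ.* 0ℤ)   ∎)
      where open ≡-Reasoning
    const-q : ℚ[ q ]
    const-q = record { seq = λ _ → fromℤ Q ; cauchy = λ k → 0 , λ _ _ _ _ → within-self k (fromℤ Q) }
    integral : ∀ a X Y u w → a ℚ.* fromℤ Y ≡ fromℤ X → (fromℤ Q ℚ.- a) ℚ.* fromℤ w ≡ fromℤ (+ (q ^ 2) ℤ.* u) →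
      (Q ℤ.* Y ℤ.- X ℤ.* 1ℤ) ℤ.* w ≡ + (q ^ 2) ℤ.* u ℤ.* (1ℤ ℤ.* Y)
    integral a X Y u w aY≡X close = fromℤ-injective (begin
      fromℤ ((Q ℤ.* Y ℤ.- X ℤ.* 1ℤ) ℤ.* w)               ≡⟨ distance-of-ratios {fromℤ Q} {a} {Q} {1ℤ} {X} {Y} w
                                                             (trans (sym (fromℤ-* Q 1ℤ)) (cong fromℤ (ℤ.*-identityʳ Q))) aY≡X ⟨
      (fromℤ Q ℚ.- a) ℚ.* fromℤ w ℚ.* fromℤ (1ℤ ℤ.* Y)   ≡⟨ cong (ℚ._* fromℤ (1ℤ ℤ.* Y)) close ⟩
      fromℤ (+ (q ^ 2) ℤ.* u) ℚ.* fromℤ (1ℤ ℤ.* Y)       ≡⟨ fromℤ-* (+ (q ^ 2) ℤ.* u) (1ℤ ℤ.* Y) ⟨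
      fromℤ (+ (q ^ 2) ℤ.* u ℤ.* (1ℤ ℤ.* Y))             ∎)
      where open ≡-Reasoning
    numerator : ∀ X Y u w → (Q ℤ.* Y ℤ.- X ℤ.* 1ℤ) ℤ.* w ≡ + (q ^ 2) ℤ.* u ℤ.* (1ℤ ℤ.* Y) →
      X ℤ.* w ≡ Q ℤ.* Y ℤ.* (w ℤ.+ Q ℤ.* ℤ.- u)
    numerator X Y u w eq = begin
      X ℤ.* w                                                    ≡⟨ rearrange Q X Y w ⟩
      Q ℤ.* Y ℤ.* w ℤ.- (Q ℤ.* Y ℤ.- X ℤ.* 1ℤ) ℤ.* w             ≡⟨ cong (λ z → Q ℤ.* Y ℤ.* w ℤ.- z) eq ⟩
      Q ℤ.* Y ℤ.* w ℤ.- + (q ^ 2) ℤ.* u ℤ.* (1ℤ ℤ.* Y)           ≡⟨ cong (λ z → Q ℤ.* Y ℤ.* w ℤ.- z ℤ.* u ℤ.* (1ℤ ℤ.* Y)) (pos-^ q 2) ⟩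
      Q ℤ.* Y ℤ.* w ℤ.- Q ℤ.^ 2 ℤ.* u ℤ.* (1ℤ ℤ.* Y)             ≡⟨ factor Q Y u w ⟩
      Q ℤ.* Y ℤ.* (w ℤ.+ Q ℤ.* ℤ.- u)                            ∎
      where
      open ≡-Reasoning
      rearrange : ∀ q X Y w → X ℤ.* w ≡ q ℤ.* Y ℤ.* w ℤ.- (q ℤ.* Y ℤ.- X ℤ.* 1ℤ) ℤ.* w
      rearrange = solve-∀
      factor : ∀ q Y u w → q ℤ.* Y ℤ.* w ℤ.- q ℤ.* (q ℤ.* 1ℤ) ℤ.* u ℤ.* (1ℤ ℤ.* Y) ≡ q ℤ.* Y ℤ.* (w ℤ.+ q ℤ.* ℤ.- u)
      factor = solve-∀
    conclude : ∀ X Y u w → q ∤ ∣ w ∣ → X ℤ.* w ≡ Q ℤ.* Y ℤ.* (w ℤ.+ Q ℤ.* ℤ.- u) →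
      (X ≢ 0ℤ → ∃ λ v → T v × HasVal q v X) → (∃ λ v → T v × HasVal q v Y) → ⊥
    conclude X Y u w q∤w Xw≡ valX (v , Tv , Yval) = compare (valX X≢0)
      where
      right : HasVal q (suc v + 0) (Q ℤ.* Y ℤ.* (w ℤ.+ Q ℤ.* ℤ.- u))
      right = val-* {suc v} {0} {Q ℤ.* Y} (val-* {1} {v} {Q} (val 1ℤ (q≡ Q) (∤1 pq)) Yval) (∤⇒val-0 (≈-∤ {b = w} (by (ℤ.- u) refl) q∤w))
        where
        q≡ : ∀ q → q ≡ q ℤ.* 1ℤ ℤ.* 1ℤ
        q≡ = solve-∀
      -- Valuations are supplied for nonzero values only. That X is nonzero follows from its
      -- closeness to q Y.
      X≢0 : X ≢ 0ℤ
      X≢0 refl = val-≢0 right (trans (sym Xw≡) (ℤ.*-zeroˡ w))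
      compare : (∃ λ v → T v × HasVal q v X) → ⊥
      compare (v′ , Tv′ , Xval) = T-gap v Tv (subst T
        (ℕ.+-cancelʳ-≡ 0 v′ (suc v) (val-unique (v′ + 0) (suc v + 0) (val-* Xval (∤⇒val-0 q∤w)) (subst (HasVal q (suc v + 0)) (sym Xw≡) right))) Tv′)
    from-value : (∃ λ a → R h a × Near q 2 const-q a) → ⊥
    from-value (a , (x , y , hy≢0 , a≡) , N , near) = from-within (near N ℕ.≤-refl)
      where
      aY≡X : a ℚ.* fromℤ (⟦ h ⟧ y) ≡ fromℤ (⟦ h ⟧ x)
      aY≡X = trans (cong (ℚ._* fromℤ (⟦ h ⟧ y)) a≡) (÷-*-fromℤ (fromℤ (⟦ h ⟧ x)) (⟦ h ⟧ y) hy≢0)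
      from-within : Within q 2 (fromℤ Q) a → ⊥
      from-within (u , w , q∤w , close) = conclude (⟦ h ⟧ x) (⟦ h ⟧ y) u (+ w) q∤w
        (numerator (⟦ h ⟧ x) (⟦ h ⟧ y) u (+ w) (integral a (⟦ h ⟧ x) (⟦ h ⟧ y) u (+ w) aY≡X close))
        (valuation x) (valuation y hy≢0)

-- Multiples of q₁q₂, q₁q₃ or q₂q₃ as valuations

SharedVal : ℕ → ℕ → ℕ → ℕ → Set
SharedVal q₁ q₂ q₃ v = (q₁ * q₂ ∣ v) ⊎ (q₁ * q₃ ∣ v) ⊎ (q₂ * q₃ ∣ v)

-- Any two of the three products, equal or not, share a prime, and it would divide both v and v + 1.
sharedVal-gap : ∀ {q₁ q₂ q₃} → Prime q₁ → Prime q₂ → Prime q₃ → ∀ v → SharedVal q₁ q₂ q₃ v → ¬ SharedVal q₁ q₂ q₃ (suc v)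
sharedVal-gap {q₁} {q₂} {q₃} pq₁ pq₂ pq₃ v = gap
  where
  common : ∀ {r} → Prime r → r ∣ v → r ∣ suc v → ⊥
  common {r} pr r∣v r∣1+v = ∤1 pr (ℕ.∣m+n∣m⇒∣n (subst (r ∣_) (ℕ.+-comm 1 v) r∣1+v) r∣v)
  left : ∀ {r s n} → r * s ∣ n → r ∣ n
  left {r} {s} = ℕ.∣-trans (ℕ.m∣m*n s)
  right : ∀ {r s n} → r * s ∣ n → s ∣ n
  right {r} {s} = ℕ.∣-trans (ℕ.n∣m*n r)
  gap : SharedVal q₁ q₂ q₃ v → SharedVal q₁ q₂ q₃ (suc v) → ⊥
  gap (inj₁ a)        (inj₁ b)        = common pq₁ (left {q₁} a) (left {q₁} b)
  gap (inj₁ a)        (inj₂ (inj₁ b)) = common pq₁ (left {q₁} a) (left {q₁} b)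
  gap (inj₁ a)        (inj₂ (inj₂ b)) = common pq₂ (right {q₁} a) (left {q₂} b)
  gap (inj₂ (inj₁ a)) (inj₁ b)        = common pq₁ (left {q₁} a) (left {q₁} b)
  gap (inj₂ (inj₁ a)) (inj₂ (inj₁ b)) = common pq₁ (left {q₁} a) (left {q₁} b)
  gap (inj₂ (inj₁ a)) (inj₂ (inj₂ b)) = common pq₃ (right {q₁} a) (right {q₂} b)
  gap (inj₂ (inj₂ a)) (inj₁ b)        = common pq₂ (left {q₂} a) (right {q₁} b)
  gap (inj₂ (inj₂ a)) (inj₂ (inj₁ b)) = common pq₃ (right {q₂} a) (right {q₁} b)
  gap (inj₂ (inj₂ a)) (inj₂ (inj₂ b)) = common pq₂ (left {q₂} a) (left {q₂} b)

module _ {q} (pq : Prime q) where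
  private
    Q = + q

  split-val : ∀ z → z ≢ 0ℤ → ∃ λ v → HasVal q v z
  split-val z z≢0 with split pq z z≢0
  ... | v , u , z≡ , q∤u = v , val u z≡ q∤u

  -- At most one of x, y, z is divisible by q, so only its power contributes besides that of w,
  -- whose exponent is a multiple of all three products.
  product-sharedVal : ∀ q₁ q₂ q₃ x y z w → x ≢ 0ℤ → y ≢ 0ℤ → z ≢ 0ℤ → w ≢ 0ℤ →
    (q ∣ ∣ x ∣ → q ∤ ∣ y ∣) → (q ∣ ∣ x ∣ → q ∤ ∣ z ∣) → (q ∣ ∣ y ∣ → q ∤ ∣ z ∣) →
    ∃ λ v → SharedVal q₁ q₂ q₃ v ×
      HasVal q v (x ℤ.^ (q₁ * q₂) ℤ.* y ℤ.^ (q₁ * q₃) ℤ.* z ℤ.^ (q₂ * q₃) ℤ.* w ℤ.^ (q₁ * q₂ * q₃))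
  product-sharedVal q₁ q₂ q₃ x y z w x≢0 y≢0 z≢0 w≢0 x|y x|z y|z = cases (q ℕ.∣? ∣ x ∣) (q ℕ.∣? ∣ y ∣)
    where
    Goal : ℕ → Set
    Goal v = HasVal q v (x ℤ.^ (q₁ * q₂) ℤ.* y ℤ.^ (q₁ * q₃) ℤ.* z ℤ.^ (q₂ * q₃) ℤ.* w ℤ.^ (q₁ * q₂ * q₃))
    d = proj₁ (split-val w w≢0)
    total : ∀ {a b c} → HasVal q a x → HasVal q b y → HasVal q c z →
      Goal (q₁ * q₂ * a + q₁ * q₃ * b + q₂ * q₃ * c + q₁ * q₂ * q₃ * d)
    total {a} {b} {c} X Y Z = val-* pq
      (val-* pq (val-* pq (val-^ pq X (q₁ * q₂)) (val-^ pq Y (q₁ * q₃))) (val-^ pq Z (q₂ * q₃)))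
      (val-^ pq (proj₂ (split-val w w≢0)) (q₁ * q₂ * q₃))
    cases : Dec (q ∣ ∣ x ∣) → Dec (q ∣ ∣ y ∣) → ∃ λ v → SharedVal q₁ q₂ q₃ v × Goal v
    cases (yes q∣x) _ = _ , inj₁ (divides (a + q₃ * d) (identity q₁ q₂ q₃ a d)) ,
      total (proj₂ (split-val x x≢0)) (∤⇒val-0 pq (x|y q∣x)) (∤⇒val-0 pq (x|z q∣x))
      where
      a = proj₁ (split-val x x≢0)
      identity : ∀ q₁ q₂ q₃ a d → q₁ * q₂ * a + q₁ * q₃ * 0 + q₂ * q₃ * 0 + q₁ * q₂ * q₃ * d ≡ (a + q₃ * d) * (q₁ * q₂)
      identity = ℕ.solve-∀
    cases (no q∤x) (yes q∣y) = _ , inj₂ (inj₁ (divides (b + q₂ * d) (identity q₁ q₂ q₃ b d))) ,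
      total (∤⇒val-0 pq q∤x) (proj₂ (split-val y y≢0)) (∤⇒val-0 pq (y|z q∣y))
      where
      b = proj₁ (split-val y y≢0)
      identity : ∀ q₁ q₂ q₃ b d → q₁ * q₂ * 0 + q₁ * q₃ * b + q₂ * q₃ * 0 + q₁ * q₂ * q₃ * d ≡ (b + q₂ * d) * (q₁ * q₃)
      identity = ℕ.solve-∀
    cases (no q∤x) (no q∤y) = _ , inj₂ (inj₂ (divides (c + q₁ * d) (identity q₁ q₂ q₃ c d))) ,
      total (∤⇒val-0 pq q∤x) (∤⇒val-0 pq q∤y) (proj₂ (split-val z z≢0))
      where
      c = proj₁ (split-val z z≢0)
      identity : ∀ q₁ q₂ q₃ c d → q₁ * q₂ * 0 + q₁ * q₃ * 0 + q₂ * q₃ * c + q₁ * q₂ * q₃ * d ≡ (c + q₁ * d) * (q₂ * q₃)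
      identity = ℕ.solve-∀

  ∣-*ʳ : ∀ a {b} → q ∣ ∣ b ∣ → q ∣ ∣ a ℤ.* b ∣
  ∣-*ʳ a {b} q∣b = subst (q ∣_) (sym (ℤ.abs-* a b)) (ℕ.∣n⇒∣m*n ∣ a ∣ q∣b)

  ∣-cancelˡ : ∀ a b → q ∤ ∣ a ∣ → q ∣ ∣ a ℤ.* b ∣ → q ∣ ∣ b ∣
  ∣-cancelˡ a b q∤a q∣ab with euclidsLemma ∣ a ∣ ∣ b ∣ pq (subst (q ∣_) (ℤ.abs-* a b) q∣ab)
  ... | inj₁ q∣a = ⊥-elim (q∤a q∣a)
  ... | inj₂ q∣b = q∣b

  ∣-- : ∀ a b → q ∣ ∣ a ∣ → q ∣ ∣ b ∣ → q ∣ ∣ a ℤ.- b ∣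
  ∣-- a b q∣a q∣b with ∣⇒multiple {q} {a} q∣a | ∣⇒multiple {q} {b} q∣b
  ... | u , refl | v , refl = multiple⇒∣ {u = u ℤ.- v} (identity Q u v)
    where
    identity : ∀ q u v → q ℤ.* u ℤ.- q ℤ.* v ≡ q ℤ.* (u ℤ.- v)
    identity = solve-∀

  ∣-∏ : ∀ φ n → q ∣ ∣ ∏ φ n ∣ → ∃ λ j → j < n × q ∣ ∣ φ j ∣
  ∣-∏ φ zero    q∣1 = ⊥-elim (∤1 pq q∣1)
  ∣-∏ φ (suc n) q∣∏ with euclidsLemma ∣ φ 0 ∣ _ pq (subst (q ∣_) (ℤ.abs-* (φ 0) _) q∣∏)
  ... | inj₁ q∣φ0 = 0 , s≤s z≤n , q∣φ0
  ... | inj₂ q∣rest with ∣-∏ (λ j → φ (suc j)) n q∣rest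
  ...   | j , j<n , q∣φ = suc j , s≤s j<n , q∣φ

-- Linear forms that vanish modulo a large prime q

module Slopes {p q} (pp : Prime p) (pq : Prime q) (N M : ℕ) (p^[N+M]<q : p ^ (N + M) < q) (0<M : 0 < M)
         (x y : ℤ) (x⊥y : ¬ ((q ∣ ∣ x ∣) × (q ∣ ∣ y ∣))) where
  private
    P = + p
    instance
      p≢0 : NonZero p
      p≢0 = prime⇒nonZero pp
    1<p : 1 < p
    1<p = ℕ.nonTrivial⇒n>1 p {{prime⇒nonTrivial pp}}

    q∤P^ : ∀ n → q ∤ ∣ P ℤ.^ n ∣
    -- Since M is positive, p ≤ p^(N+M) < q, so p is invertible modulo q.
    q∤P^ n = ∤-^ pq P n (ℕ.>⇒∤ (ℕ.≤-<-trans
      (subst (_≤ p ^ (N + M)) (ℕ.^-identityʳ p) (ℕ.^-monoʳ-≤ p (ℕ.≤-trans 0<M (ℕ.m≤n+m M N)))) p^[N+M]<q))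

    -- Up to a power of p, x + pʲ y is the case s = N + j and pⁱ x + y the case s = N ∸ i.
    Slope : ℕ → Set
    Slope s = q ∣ ∣ P ℤ.^ N ℤ.* x ℤ.+ P ℤ.^ s ℤ.* y ∣

    -- If q also divided y, it would divide p^N x and hence x, against primitivity of the pair.
    slope⇒∤y : ∀ s → Slope s → q ∤ ∣ y ∣
    slope⇒∤y s slope q∣y = x⊥y (∣-cancelˡ pq (P ℤ.^ N) x (q∤P^ N)
      (subst (λ z → q ∣ ∣ z ∣) (cancel (P ℤ.^ N ℤ.* x) (P ℤ.^ s ℤ.* y)) (∣-- pq (P ℤ.^ N ℤ.* x ℤ.+ P ℤ.^ s ℤ.* y) (P ℤ.^ s ℤ.* y) slope (∣-*ʳ pq (P ℤ.^ s) {y} q∣y))) , q∣y)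
      where
      cancel : ∀ a b → a ℤ.+ b ℤ.- b ≡ a
      cancel = solve-∀

    slope⇒∤x : ∀ s → Slope s → q ∤ ∣ x ∣
    slope⇒∤x s slope q∣x = x⊥y (q∣x , ∣-cancelˡ pq (P ℤ.^ s) y (q∤P^ s)
      (subst (λ z → q ∣ ∣ z ∣) (cancel (P ℤ.^ N ℤ.* x) (P ℤ.^ s ℤ.* y)) (∣-- pq (P ℤ.^ N ℤ.* x ℤ.+ P ℤ.^ s ℤ.* y) (P ℤ.^ N ℤ.* x) slope (∣-*ʳ pq (P ℤ.^ N) {x} q∣x))))
      where
      cancel : ∀ a b → a ℤ.+ b ℤ.- a ≡ b
      cancel = solve-∀

    -- The difference of the two forms is p^s (p^k - 1) y with k = s′ - s. None of the factors is
    -- divisible by q: the middle one is positive and below p^(N+M) < q.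
    slopes-distinct : ∀ {s s′} → s < s′ → s′ ≤ N + M → Slope s → ¬ Slope s′
    slopes-distinct {s} {s′} s<s′ s′≤N+M slope slope′ = slope⇒∤y s slope
      (∣-cancelˡ pq (+ (p ^ k ∸ 1)) y q∤p^k-1 (∣-cancelˡ pq (P ℤ.^ s) (+ (p ^ k ∸ 1) ℤ.* y) (q∤P^ s)
        (subst (λ z → q ∣ ∣ z ∣) difference (∣-- pq (P ℤ.^ N ℤ.* x ℤ.+ P ℤ.^ s′ ℤ.* y) (P ℤ.^ N ℤ.* x ℤ.+ P ℤ.^ s ℤ.* y) slope′ slope))))
      where
      k = s′ ∸ s
      1<p^k : 1 < p ^ k
      1<p^k = ℕ.^-monoʳ-< p 1<p {0} (ℕ.m<n⇒0<n∸m s<s′)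
      q∤p^k-1 : q ∤ p ^ k ∸ 1
      q∤p^k-1 = ℕ.>⇒∤ {{ℕ.>-nonZero (ℕ.m<n⇒0<n∸m 1<p^k)}}
        (ℕ.≤-<-trans (ℕ.m∸n≤m (p ^ k) 1) (ℕ.≤-<-trans (ℕ.^-monoʳ-≤ p (ℕ.≤-trans (ℕ.m∸n≤m s′ s) s′≤N+M)) p^[N+M]<q))
      P^s′ : P ℤ.^ s′ ≡ P ℤ.^ s ℤ.* P ℤ.^ k
      P^s′ = trans (cong (P ℤ.^_) (sym (ℕ.m+[n∸m]≡n (ℕ.<⇒≤ s<s′)))) (ℤ.^-distribˡ-+-* P s k)
      p^k-1 : + (p ^ k ∸ 1) ≡ P ℤ.^ k ℤ.- 1ℤ
      p^k-1 = trans (sym (trans (ℤ.m-n≡m⊖n (p ^ k) 1) (ℤ.⊖-≥ (ℕ.<⇒≤ 1<p^k)))) (cong (ℤ._- 1ℤ) (pos-^ p k))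
      identity : ∀ a s k y → a ℤ.+ s ℤ.* k ℤ.* y ℤ.- (a ℤ.+ s ℤ.* y) ≡ s ℤ.* ((k ℤ.- 1ℤ) ℤ.* y)
      identity = solve-∀
      difference : P ℤ.^ N ℤ.* x ℤ.+ P ℤ.^ s′ ℤ.* y ℤ.- (P ℤ.^ N ℤ.* x ℤ.+ P ℤ.^ s ℤ.* y) ≡ P ℤ.^ s ℤ.* (+ (p ^ k ∸ 1) ℤ.* y)
      difference = trans (cong (λ z → P ℤ.^ N ℤ.* x ℤ.+ z ℤ.* y ℤ.- (P ℤ.^ N ℤ.* x ℤ.+ P ℤ.^ s ℤ.* y)) P^s′)
        (trans (identity (P ℤ.^ N ℤ.* x) (P ℤ.^ s) (P ℤ.^ k) y) (cong (λ z → P ℤ.^ s ℤ.* (z ℤ.* y)) (sym p^k-1)))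

  Upper Lower : ℕ → Set
  Upper j = q ∣ ∣ x ℤ.+ + (p ^ j) ℤ.* y ∣
  Lower i = q ∣ ∣ + (p ^ i) ℤ.* x ℤ.+ y ∣

  private
    upper⇒slope : ∀ j → Upper j → Slope (N + j)
    upper⇒slope j upper = subst (λ z → q ∣ ∣ z ∣) eq (∣-*ʳ pq (P ℤ.^ N) {x ℤ.+ + (p ^ j) ℤ.* y} upper)
      where
      identity : ∀ a b x y → a ℤ.* (x ℤ.+ b ℤ.* y) ≡ a ℤ.* x ℤ.+ a ℤ.* b ℤ.* y
      identity = solve-∀
      eq : P ℤ.^ N ℤ.* (x ℤ.+ + (p ^ j) ℤ.* y) ≡ P ℤ.^ N ℤ.* x ℤ.+ P ℤ.^ (N + j) ℤ.* y
      eq = trans (cong (λ z → P ℤ.^ N ℤ.* (x ℤ.+ z ℤ.* y)) (pos-^ p j))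
        (trans (identity (P ℤ.^ N) (P ℤ.^ j) x y) (cong (λ z → P ℤ.^ N ℤ.* x ℤ.+ z ℤ.* y) (sym (ℤ.^-distribˡ-+-* P N j))))

    lower⇒slope : ∀ i → i ≤ N → Lower i → Slope (N ∸ i)
    lower⇒slope i i≤N lower = subst (λ z → q ∣ ∣ z ∣) eq (∣-*ʳ pq (P ℤ.^ (N ∸ i)) {+ (p ^ i) ℤ.* x ℤ.+ y} lower)
      where
      identity : ∀ a b x y → a ℤ.* (b ℤ.* x ℤ.+ y) ≡ a ℤ.* b ℤ.* x ℤ.+ a ℤ.* y
      identity = solve-∀
      eq : P ℤ.^ (N ∸ i) ℤ.* (+ (p ^ i) ℤ.* x ℤ.+ y) ≡ P ℤ.^ N ℤ.* x ℤ.+ P ℤ.^ (N ∸ i) ℤ.* y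
      eq = trans (cong (λ z → P ℤ.^ (N ∸ i) ℤ.* (z ℤ.* x ℤ.+ y)) (pos-^ p i))
        (trans (identity (P ℤ.^ (N ∸ i)) (P ℤ.^ i) x y)
          (cong (λ z → z ℤ.* x ℤ.+ P ℤ.^ (N ∸ i) ℤ.* y)
            (trans (sym (ℤ.^-distribˡ-+-* P (N ∸ i) i)) (cong (P ℤ.^_) (ℕ.m∸n+n≡m i≤N)))))

  upper⇒∤x : ∀ j → Upper j → q ∤ ∣ x ∣
  upper⇒∤x j upper = slope⇒∤x (N + j) (upper⇒slope j upper)

  lower⇒∤x : ∀ i → i ≤ N → Lower i → q ∤ ∣ x ∣
  lower⇒∤x i i≤N lower = slope⇒∤x (N ∸ i) (lower⇒slope i i≤N lower)

  upper-upper : ∀ {j j′} → j < j′ → j′ ≤ M → Upper j → ¬ Upper j′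
  upper-upper j<j′ j′≤M upper upper′ =
    slopes-distinct (ℕ.+-monoʳ-< N j<j′) (ℕ.+-monoʳ-≤ N j′≤M) (upper⇒slope _ upper) (upper⇒slope _ upper′)

  lower-upper : ∀ {i j} → i ≤ N → 0 < j → j ≤ M → Lower i → ¬ Upper j
  lower-upper {i} {j} i≤N 0<j j≤M lower upper = slopes-distinct
    (ℕ.≤-<-trans (ℕ.m∸n≤m N i) (subst (_≤ N + j) (ℕ.+-comm N 1) (ℕ.+-monoʳ-≤ N 0<j)))
    (ℕ.+-monoʳ-≤ N j≤M) (lower⇒slope i i≤N lower) (upper⇒slope j upper)

  -- A larger exponent i has a smaller slope N - i, so the two forms change places.
  lower-lower : ∀ {i i′} → i < i′ → i′ ≤ N → Lower i → ¬ Lower i′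
  lower-lower {i} {i′} i<i′ i′≤N lower lower′ = slopes-distinct
    (ℕ.∸-monoʳ-< i<i′ i′≤N) (ℕ.≤-trans (ℕ.m∸n≤m N i) (ℕ.m≤m+n N M))
    (lower⇒slope i′ i′≤N lower′) (lower⇒slope i (ℕ.≤-trans (ℕ.<⇒≤ i<i′) i′≤N) lower)

-- Valuations of the common form at a large prime q

left≢0 : ∀ {a b} → a ℤ.* b ≢ 0ℤ → a ≢ 0ℤ
left≢0 {b = b} ab≢0 refl = ab≢0 (ℤ.*-zeroˡ b)

right≢0 : ∀ a {b} → a ℤ.* b ≢ 0ℤ → b ≢ 0ℤ
right≢0 a ab≢0 refl = ab≢0 (ℤ.*-zeroʳ a)

base≢0 : ∀ {a} n .{{_ : NonZero n}} → a ℤ.^ n ≢ 0ℤ → a ≢ 0ℤ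
base≢0 (suc n) = left≢0

-- The inequalities put the exponents of the forms pⁱ x + y into successive ranges: below a in the
-- first block, from a to b - 1 in the second, from b to N in the third. Hence no slope occurs in
-- two blocks. The factor w stands for whatever enters as a q₁q₂q₃-th power.
form-sharedVal : ∀ {p q} → Prime p → Prime q → ∀ q₁ q₂ q₃ #C a #D b #E N → p ^ (N + suc q₁) < q →
  #C ≤ N → #C < a → a + #D ≤ b → b + #E ≤ suc N → ∀ x y w → ¬ ((q ∣ ∣ x ∣) × (q ∣ ∣ y ∣)) →
  let h = form p q₁ q₂ q₃ #C a #D b #E x y ℤ.* w ℤ.^ (q₁ * q₂ * q₃) in
  .{{_ : NonZero q₁}} .{{_ : NonZero q₂}} .{{_ : NonZero q₃}} →
  h ≢ 0ℤ → ∃ λ v → SharedVal q₁ q₂ q₃ v × HasVal q v h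
form-sharedVal {p} {q} pp pq q₁ q₂ q₃ #C a #D b #E N p^<q #C≤N #C<a a+#D≤b b+#E≤1+N x y w x⊥y h≢0 =
  product-sharedVal pq q₁ q₂ q₃ B₁₂ B₁₃ B₂₃ w
    (base≢0 (q₁ * q₂) (left≢0 (left≢0 (left≢0 h≢0)))) (base≢0 (q₁ * q₃) (right≢0 (B₁₂ ℤ.^ (q₁ * q₂)) (left≢0 (left≢0 h≢0))))
    (base≢0 (q₂ * q₃) (right≢0 (B₁₂ ℤ.^ (q₁ * q₂) ℤ.* B₁₃ ℤ.^ (q₁ * q₃)) (left≢0 h≢0)))
    (base≢0 (q₁ * q₂ * q₃) (right≢0 (form p q₁ q₂ q₃ #C a #D b #E x y) h≢0))
    (λ l m → disjoint₁₂₋₁₃ (divides₁₂ l) (divides₁₃ m))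
    (λ l m → disjoint₁₂₋₂₃ (divides₁₂ l) (divides₂₃ m))
    (λ l m → disjoint₁₃₋₂₃ (divides₁₃ l) (divides₂₃ m))
  where
  B₁₂ = block₁₂ p q₁ q₂ q₃ #C a #D b #E x y
  B₁₃ = block₁₃ p q₁ q₂ q₃ #C a #D b #E x y
  B₂₃ = block₂₃ p q₁ q₂ q₃ #C a #D b #E x y
  instance
    q₁q₂≢0 = ℕ.m*n≢0 q₁ q₂
    q₁q₃≢0 = ℕ.m*n≢0 q₁ q₃
    q₂q₃≢0 = ℕ.m*n≢0 q₂ q₃
    q₁q₂q₃≢0 = ℕ.m*n≢0 (q₁ * q₂) q₃
  0<M : 0 < suc q₁
  0<M = s≤s z≤n
  open Slopes pp pq N (suc q₁) p^<q 0<M x y x⊥y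
  divides-product : ∀ a b → q ∣ ∣ a ℤ.* b ∣ → (q ∣ ∣ a ∣) ⊎ (q ∣ ∣ b ∣)
  divides-product a b q∣ab = euclidsLemma ∣ a ∣ ∣ b ∣ pq (subst (q ∣_) (ℤ.abs-* a b) q∣ab)

  -- These types record which linear form of a block q divides, with the range of its exponent. The
  -- form x has no slope of its own and is compared with the others through `upper⇒∤x` and
  -- `lower⇒∤x`.
  data Divisor₁₂ : Set where
    is-x  : q ∣ ∣ x ∣ → Divisor₁₂
    is-C  : ∀ i → i < a → i ≤ N → Lower i → Divisor₁₂
  data Divisor₁₃ : Set where
    is-A  : ∀ j → 0 < j → j ≤ q₁ → Upper j → Divisor₁₃
    is-D  : ∀ i → a ≤ i → i < b → i ≤ N → Lower i → Divisor₁₃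
  data Divisor₂₃ : Set where
    is-B  : Upper (suc q₁) → Divisor₂₃
    is-E  : ∀ i → b ≤ i → i ≤ N → Lower i → Divisor₂₃

  divides₁₂ : q ∣ ∣ B₁₂ ∣ → Divisor₁₂
  divides₁₂ q∣ with divides-product x _ q∣
  ... | inj₁ q∣x = is-x q∣x
  ... | inj₂ q∣∏ with ∣-∏ pq _ #C q∣∏
  ...   | j , j<#C , lo = is-C (suc j) (ℕ.≤-<-trans j<#C #C<a) (ℕ.≤-trans j<#C #C≤N) lo

  divides₁₃ : q ∣ ∣ B₁₃ ∣ → Divisor₁₃
  divides₁₃ q∣ with divides-product (∏ (λ j → x ℤ.+ + (p ^ suc j) ℤ.* y) q₁) _ q∣
  ... | inj₁ q∣∏ with ∣-∏ pq _ q₁ q∣∏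
  ...   | j , j<q₁ , up = is-A (suc j) (s≤s z≤n) j<q₁ up
  divides₁₃ q∣ | inj₂ q∣∏ with ∣-∏ pq _ #D q∣∏
  ...   | j , j<#D , lo = is-D (a + j) (ℕ.m≤m+n a j) a+j<b
    (ℕ.≤-pred (ℕ.<-≤-trans a+j<b (ℕ.≤-trans (ℕ.m≤m+n b #E) b+#E≤1+N))) lo
    where
    a+j<b : a + j < b
    a+j<b = ℕ.<-≤-trans (ℕ.+-monoʳ-< a j<#D) a+#D≤b

  divides₂₃ : q ∣ ∣ B₂₃ ∣ → Divisor₂₃
  divides₂₃ q∣ with divides-product (x ℤ.+ + (p ^ (q₁ + 1)) ℤ.* y) _ q∣
  ... | inj₁ up = is-B (subst Upper (ℕ.+-comm q₁ 1) up)
  ... | inj₂ q∣∏ with ∣-∏ pq _ #E q∣∏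
  ...   | j , j<#E , lo = is-E (b + j) (ℕ.m≤m+n b j) (ℕ.≤-pred (ℕ.<-≤-trans (ℕ.+-monoʳ-< b j<#E) b+#E≤1+N)) lo

  a≤b : a ≤ b
  a≤b = ℕ.≤-trans (ℕ.m≤m+n a #D) a+#D≤b

  disjoint₁₂₋₁₃ : Divisor₁₂ → Divisor₁₃ → ⊥
  disjoint₁₂₋₁₃ (is-x q∣x)          (is-A j 0<j j≤q₁ up)       = upper⇒∤x j up q∣x
  disjoint₁₂₋₁₃ (is-x q∣x)          (is-D i _ _ i≤N lo)        = lower⇒∤x i i≤N lo q∣x
  disjoint₁₂₋₁₃ (is-C i _ i≤N lo)   (is-A j 0<j j≤q₁ up)       = lower-upper i≤N 0<j (ℕ.m≤n⇒m≤1+n j≤q₁) lo up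
  disjoint₁₂₋₁₃ (is-C i i<a _ lo)   (is-D i′ a≤i′ _ i′≤N lo′)  = lower-lower (ℕ.<-≤-trans i<a a≤i′) i′≤N lo lo′

  disjoint₁₂₋₂₃ : Divisor₁₂ → Divisor₂₃ → ⊥
  disjoint₁₂₋₂₃ (is-x q∣x)          (is-B up)                  = upper⇒∤x (suc q₁) up q∣x
  disjoint₁₂₋₂₃ (is-x q∣x)          (is-E i _ i≤N lo)          = lower⇒∤x i i≤N lo q∣x
  disjoint₁₂₋₂₃ (is-C i _ i≤N lo)   (is-B up)                  = lower-upper i≤N (s≤s z≤n) ℕ.≤-refl lo up
  disjoint₁₂₋₂₃ (is-C i i<a _ lo)   (is-E i′ b≤i′ i′≤N lo′)    = lower-lower (ℕ.<-≤-trans i<a (ℕ.≤-trans a≤b b≤i′)) i′≤N lo lo′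

  disjoint₁₃₋₂₃ : Divisor₁₃ → Divisor₂₃ → ⊥
  disjoint₁₃₋₂₃ (is-A j 0<j j≤q₁ up)   (is-B up′)              = upper-upper (s≤s j≤q₁) ℕ.≤-refl up up′
  disjoint₁₃₋₂₃ (is-A j 0<j j≤q₁ up)   (is-E i _ i≤N lo)       = lower-upper i≤N 0<j (ℕ.m≤n⇒m≤1+n j≤q₁) lo up
  disjoint₁₃₋₂₃ (is-D i _ _ i≤N lo)    (is-B up)               = lower-upper i≤N (s≤s z≤n) ℕ.≤-refl lo up
  disjoint₁₃₋₂₃ (is-D i _ i<b _ lo)    (is-E i′ b≤i′ i′≤N lo′) = lower-lower (ℕ.<-≤-trans i<b b≤i′) i′≤N lo lo′

-- Evaluation of f, g₂ and gₙ

∏-cong : ∀ {φ ψ} n → (∀ j → φ j ≡ ψ j) → ∏ φ n ≡ ∏ ψ n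
∏-cong zero    eq = refl
∏-cong (suc n) eq = cong₂ ℤ._*_ (eq 0) (∏-cong n λ j → eq (suc j))

∏-scale : ∀ c {φ ψ} n → (∀ j → φ j ≡ c ℤ.* ψ j) → ∏ φ n ≡ c ℤ.^ n ℤ.* ∏ ψ n
∏-scale c zero    eq = refl
∏-scale c {φ} {ψ} (suc n) eq = trans (cong₂ ℤ._*_ (eq 0) (∏-scale c n λ j → eq (suc j)))
  (shuffle c (ψ 0) (c ℤ.^ n) (∏ (λ j → ψ (suc j)) n))
  where
  shuffle : ∀ a b c d → a ℤ.* b ℤ.* (c ℤ.* d) ≡ a ℤ.* c ℤ.* (b ℤ.* d)
  shuffle = solve-∀

-- The three equations count linear forms: the blocks have degrees q₃, q₂ and q₁. With the exponents
-- q₁q₂, q₁q₃ and q₂q₃, each block contributes one factor c^(q₁q₂q₃).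
form-scale : ∀ p {q₁ q₂ q₃ #C #D #E} a b → suc #C ≡ q₃ → q₁ + #D ≡ q₂ → suc #E ≡ q₁ → ∀ c x y →
  form p q₁ q₂ q₃ #C a #D b #E (c ℤ.* x) (c ℤ.* y) ≡ form p q₁ q₂ q₃ #C a #D b #E x y ℤ.* (c ℤ.* c ℤ.* c) ℤ.^ (q₁ * q₂ * q₃)
form-scale p {q₁} {q₂} {q₃} {#C} {#D} {#E} a b refl refl refl c x y = begin
  B₁₂′ ℤ.^ (q₁ * q₂) ℤ.* B₁₃′ ℤ.^ (q₁ * q₃) ℤ.* B₂₃′ ℤ.^ (q₂ * q₃)
    ≡⟨ cong₂ ℤ._*_ (cong₂ ℤ._*_
         (scaled q₃ (q₁ * q₂) c^-₁₂ (ℕ.*-comm q₃ (q₁ * q₂)))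
         (scaled q₂ (q₁ * q₃) c^-₁₃ (exponent₁₃ q₁ q₂ q₃)))
         (scaled q₁ (q₂ * q₃) c^-₂₃ (sym (ℕ.*-assoc q₁ q₂ q₃))) ⟩
  c ℤ.^ (q₁ * q₂ * q₃) ℤ.* B₁₂ ℤ.^ (q₁ * q₂) ℤ.* (c ℤ.^ (q₁ * q₂ * q₃) ℤ.* B₁₃ ℤ.^ (q₁ * q₃)) ℤ.* (c ℤ.^ (q₁ * q₂ * q₃) ℤ.* B₂₃ ℤ.^ (q₂ * q₃))
    ≡⟨ collect (c ℤ.^ (q₁ * q₂ * q₃)) (B₁₂ ℤ.^ (q₁ * q₂)) (B₁₃ ℤ.^ (q₁ * q₃)) (B₂₃ ℤ.^ (q₂ * q₃)) ⟩
  form p q₁ q₂ q₃ #C a #D b #E x y ℤ.* (c ℤ.^ (q₁ * q₂ * q₃) ℤ.* c ℤ.^ (q₁ * q₂ * q₃) ℤ.* c ℤ.^ (q₁ * q₂ * q₃))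
    ≡⟨ cong (ℤ._*_ (form p q₁ q₂ q₃ #C a #D b #E x y))
         (trans (cong (ℤ._* c ℤ.^ (q₁ * q₂ * q₃)) (sym (^-distrib-* c c (q₁ * q₂ * q₃)))) (sym (^-distrib-* (c ℤ.* c) c (q₁ * q₂ * q₃)))) ⟩
  form p q₁ q₂ q₃ #C a #D b #E x y ℤ.* (c ℤ.* c ℤ.* c) ℤ.^ (q₁ * q₂ * q₃) ∎
  where
  open ≡-Reasoning
  B₁₂ = block₁₂ p q₁ q₂ q₃ #C a #D b #E x y
  B₁₃ = block₁₃ p q₁ q₂ q₃ #C a #D b #E x y
  B₂₃ = block₂₃ p q₁ q₂ q₃ #C a #D b #E x y
  B₁₂′ = block₁₂ p q₁ q₂ q₃ #C a #D b #E (c ℤ.* x) (c ℤ.* y)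
  B₁₃′ = block₁₃ p q₁ q₂ q₃ #C a #D b #E (c ℤ.* x) (c ℤ.* y)
  B₂₃′ = block₂₃ p q₁ q₂ q₃ #C a #D b #E (c ℤ.* x) (c ℤ.* y)
  upper : ∀ s → c ℤ.* x ℤ.+ s ℤ.* (c ℤ.* y) ≡ c ℤ.* (x ℤ.+ s ℤ.* y)
  upper s = identity c s x y
    where
    identity : ∀ c s x y → c ℤ.* x ℤ.+ s ℤ.* (c ℤ.* y) ≡ c ℤ.* (x ℤ.+ s ℤ.* y)
    identity = solve-∀
  lower : ∀ s → s ℤ.* (c ℤ.* x) ℤ.+ c ℤ.* y ≡ c ℤ.* (s ℤ.* x ℤ.+ y)
  lower s = identity c s x y
    where
    identity : ∀ c s x y → s ℤ.* (c ℤ.* x) ℤ.+ c ℤ.* y ≡ c ℤ.* (s ℤ.* x ℤ.+ y)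
    identity = solve-∀
  shuffle : ∀ a b c d → a ℤ.* b ℤ.* (c ℤ.* d) ≡ a ℤ.* c ℤ.* (b ℤ.* d)
  shuffle = solve-∀
  collect : ∀ k x y z → k ℤ.* x ℤ.* (k ℤ.* y) ℤ.* (k ℤ.* z) ≡ x ℤ.* y ℤ.* z ℤ.* (k ℤ.* k ℤ.* k)
  collect = solve-∀
  c^-₁₂ : B₁₂′ ≡ c ℤ.^ q₃ ℤ.* B₁₂
  c^-₁₂ = trans (cong (ℤ._*_ (c ℤ.* x)) (∏-scale c #C λ j → lower (+ (p ^ suc j)))) (shuffle c x (c ℤ.^ #C) _)
  c^-₁₃ : B₁₃′ ≡ c ℤ.^ q₂ ℤ.* B₁₃
  c^-₁₃ = trans (cong₂ ℤ._*_ (∏-scale c q₁ λ j → upper (+ (p ^ suc j))) (∏-scale c #D λ j → lower (+ (p ^ (a + j)))))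
    (trans (shuffle (c ℤ.^ q₁) _ (c ℤ.^ #D) _) (cong (ℤ._* B₁₃) (sym (ℤ.^-distribˡ-+-* c q₁ #D))))
  c^-₂₃ : B₂₃′ ≡ c ℤ.^ q₁ ℤ.* B₂₃
  c^-₂₃ = trans (cong₂ ℤ._*_ (upper (+ (p ^ (q₁ + 1)))) (∏-scale c #E λ j → lower (+ (p ^ (b + j))))) (shuffle c _ (c ℤ.^ #E) _)
  scaled : ∀ {B B′ n} k m → B′ ≡ c ℤ.^ k ℤ.* B → k * m ≡ n → B′ ℤ.^ m ≡ c ℤ.^ n ℤ.* B ℤ.^ m
  scaled {B} k m refl refl = trans (^-distrib-* (c ℤ.^ k) B m) (cong (ℤ._* B ℤ.^ m) (ℤ.^-*-assoc c k m))
  exponent₁₃ : ∀ q₁ q₂ q₃ → q₂ * (q₁ * q₃) ≡ q₁ * q₂ * q₃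
  exponent₁₃ = ℕ.solve-∀

⟦:^⟧ : ∀ {n} (h : Polynomial n) k v → ⟦ h :^ k ⟧ v ≡ ⟦ h ⟧ v ℤ.^ k
⟦:^⟧ h zero    v = refl
⟦:^⟧ h (suc k) v = cong (ℤ._*_ (⟦ h ⟧ v)) (⟦:^⟧ h k v)

⟦∏⟧ : ∀ {n} (L : ℕ → Polynomial n) m k v →
  ⟦ foldr _:*_ (con 1ℤ) (applyUpTo (λ j → L j :^ m) k) ⟧ v ≡ ∏ (λ j → ⟦ L j ⟧ v) k ℤ.^ m
⟦∏⟧ L m zero    v = sym (ℤ.^-zeroˡ m)
⟦∏⟧ L m (suc k) v = trans (cong₂ ℤ._*_ (⟦:^⟧ (L 0) m v) (⟦∏⟧ (λ j → L (suc j)) m k v))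
  (sym (^-distrib-* (⟦ L 0 ⟧ v) (∏ (λ j → ⟦ L (suc j) ⟧ v) k) m))

⟦∏-vars⟧ : ∀ {n} m (h : Fin m → Fin n) v → (∀ j → lookup v (h j) ≡ 1ℤ) →
  ⟦ foldr _:*_ (con 1ℤ) (tabulate (λ j → var (h j))) ⟧ v ≡ 1ℤ
⟦∏-vars⟧ zero    h v ones = refl
⟦∏-vars⟧ (suc m) h v ones = cong₂ ℤ._*_ (ones zero) (⟦∏-vars⟧ m (λ j → h (suc j)) v λ j → ones (suc j))

module _ (p q₁ q₂ q₃ : ℕ) where

  ⟦f⟧ : ∀ x → ⟦ f p q₁ q₂ q₃ ⟧ (x ∷ []) ≡ form p q₁ q₂ q₃ 0 1 0 1 0 x 1ℤ
  ⟦f⟧ x = cong₂ ℤ._*_ (cong₂ ℤ._*_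
    (trans (⟦:^⟧ (var zero) (q₁ * q₂) (x ∷ [])) (cong (ℤ._^ (q₁ * q₂)) (sym (ℤ.*-identityʳ x))))
    (trans (⟦∏⟧ (λ j → var zero :+ con (+ (p ^ suc j))) (q₁ * q₃) q₁ (x ∷ []))
      (cong (ℤ._^ (q₁ * q₃)) (trans (∏-cong q₁ λ j → cong (ℤ._+_ x) (sym (ℤ.*-identityʳ (+ (p ^ suc j)))))
        (sym (ℤ.*-identityʳ (∏ (λ j → x ℤ.+ + (p ^ suc j) ℤ.* 1ℤ) q₁)))))))
    (trans (⟦:^⟧ (var zero :+ con (+ (p ^ (q₁ + 1)))) (q₂ * q₃) (x ∷ []))
      (cong (ℤ._^ (q₂ * q₃)) (trans (cong (ℤ._+_ x) (sym (ℤ.*-identityʳ (+ (p ^ (q₁ + 1))))))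
        (sym (ℤ.*-identityʳ (x ℤ.+ + (p ^ (q₁ + 1)) ℤ.* 1ℤ))))))

  -- The lengths are written as `∏[_⋯_]` computes them, so that evaluation needs no conversion.
  -- Their values q₃ - 1, q₂ - q₁ and q₁ - 1 follow once the order of the primes is available.
  #C #D #E : ℕ
  #C = q₃ ∸ 1
  #D = suc (q₃ + q₂ ∸ q₁ ∸ 1) ∸ q₃
  #E = suc (q₃ + q₂ ∸ 2) ∸ (q₃ + q₂ ∸ q₁)

  g₂-form : ℤ → ℤ → ℤ
  g₂-form = form p q₁ q₂ q₃ #C q₃ #D (q₃ + q₂ ∸ q₁) #E

  ⟦g₂⟧ : ∀ {n} (X Y : Polynomial n) v → ⟦ g₂⟨_,_⟩ p q₁ q₂ q₃ X Y ⟧ v ≡ g₂-form (⟦ X ⟧ v) (⟦ Y ⟧ v)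
  ⟦g₂⟧ X Y v = trans (cong₂ ℤ._*_ (cong₂ ℤ._*_ (cong₂ ℤ._*_ (cong₂ ℤ._*_ (cong₂ ℤ._*_
      (⟦:^⟧ X (q₁ * q₂) v)
      (⟦∏⟧ (λ j → X :+ con (+ (p ^ suc j)) :* Y) (q₁ * q₃) q₁ v))
      (⟦:^⟧ (X :+ con (+ (p ^ (q₁ + 1))) :* Y) (q₂ * q₃) v))
      (⟦∏⟧ (λ j → con (+ (p ^ suc j)) :* X :+ Y) (q₁ * q₂) #C v))
      (⟦∏⟧ (λ j → con (+ (p ^ (q₃ + j))) :* X :+ Y) (q₁ * q₃) #D v))
      (⟦∏⟧ (λ j → con (+ (p ^ (q₃ + q₂ ∸ q₁ + j))) :* X :+ Y) (q₂ * q₃) #E v))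
    (regroup x A B K D E)
    where
    x = ⟦ X ⟧ v
    y = ⟦ Y ⟧ v
    A = ∏ (λ j → x ℤ.+ + (p ^ suc j) ℤ.* y) q₁
    B = x ℤ.+ + (p ^ (q₁ + 1)) ℤ.* y
    K = ∏ (λ j → + (p ^ suc j) ℤ.* x ℤ.+ y) #C
    D = ∏ (λ j → + (p ^ (q₃ + j)) ℤ.* x ℤ.+ y) #D
    E = ∏ (λ j → + (p ^ (q₃ + q₂ ∸ q₁ + j)) ℤ.* x ℤ.+ y) #E
    regroup : ∀ x A B K D E →
      x ℤ.^ (q₁ * q₂) ℤ.* A ℤ.^ (q₁ * q₃) ℤ.* B ℤ.^ (q₂ * q₃) ℤ.* K ℤ.^ (q₁ * q₂) ℤ.* D ℤ.^ (q₁ * q₃) ℤ.* E ℤ.^ (q₂ * q₃)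
      ≡ (x ℤ.* K) ℤ.^ (q₁ * q₂) ℤ.* (A ℤ.* D) ℤ.^ (q₁ * q₃) ℤ.* (B ℤ.* E) ℤ.^ (q₂ * q₃)
    regroup x A B K D E
      rewrite ^-distrib-* x K (q₁ * q₂) | ^-distrib-* A D (q₁ * q₃) | ^-distrib-* B E (q₂ * q₃) =
      shuffle (x ℤ.^ (q₁ * q₂)) (A ℤ.^ (q₁ * q₃)) (B ℤ.^ (q₂ * q₃)) (K ℤ.^ (q₁ * q₂)) (D ℤ.^ (q₁ * q₃)) (E ℤ.^ (q₂ * q₃))
      where
      shuffle : ∀ x A B K D E → x ℤ.* A ℤ.* B ℤ.* K ℤ.* D ℤ.* E ≡ x ℤ.* K ℤ.* (A ℤ.* D) ℤ.* (B ℤ.* E)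
      shuffle = solve-∀

-- Index ranges of g₂ and assembly of the three statements

almost-all : ∀ {S} B → (∀ q → Prime q → B < q → ¬ DenseIn q S) → NotDenseForAlmostAllPrimes S
almost-all B not-dense-beyond = upTo (suc B) , λ q pq q∉ →
  not-dense-beyond q pq (ℕ.≰⇒> λ q≤B → q∉ (∈-upTo⁺ (s≤s q≤B)))

module _ {p q₁ q₂ q₃ : ℕ} (pp : Prime p) (pq₁ : Prime q₁) (pq₂ : Prime q₂) (pq₃ : Prime q₃)
         (q₁<q₂ : q₁ < q₂) (q₂<q₃ : q₂ < q₃) (cop : Coprime (q₁ * q₂ * q₃) (p * (p ∸ 1))) where

  private
    instance
      q₁≢0 = prime⇒nonZero pq₁
      q₂≢0 = prime⇒nonZero pq₂
      q₃≢0 = prime⇒nonZero pq₃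
    1<q₁ : 1 < q₁
    1<q₁ = ℕ.nonTrivial⇒n>1 q₁ {{prime⇒nonTrivial pq₁}}
    0<q₁ : 0 < q₁
    0<q₁ = ℕ.<⇒≤ 1<q₁
    Q = q₁ * q₂ * q₃
    c = #C p q₁ q₂ q₃
    d = #D p q₁ q₂ q₃
    e = #E p q₁ q₂ q₃
    b = q₃ + q₂ ∸ q₁
    N = q₃ + q₂ ∸ 2
    G = g₂-form p q₁ q₂ q₃
    1+c≡q₃ : suc c ≡ q₃
    1+c≡q₃ = ℕ.m+[n∸m]≡n (ℕ.>-nonZero⁻¹ q₃)
    q₁≤q₃+q₂ : q₁ ≤ q₃ + q₂
    q₁≤q₃+q₂ = ℕ.≤-trans (ℕ.<⇒≤ q₁<q₂) (ℕ.m≤n+m q₂ q₃)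
    2+N≡ : suc (suc N) ≡ q₃ + q₂
    2+N≡ = ℕ.m+[n∸m]≡n (ℕ.≤-trans 1<q₁ q₁≤q₃+q₂)
    b≡q₃+[q₂∸q₁] : b ≡ q₃ + (q₂ ∸ q₁)
    b≡q₃+[q₂∸q₁] = ℕ.+-∸-assoc q₃ (ℕ.<⇒≤ q₁<q₂)
    q₃≤b : q₃ ≤ b
    q₃≤b = subst (q₃ ≤_) (sym b≡q₃+[q₂∸q₁]) (ℕ.m≤m+n q₃ (q₂ ∸ q₁))
    d≡b∸q₃ : d ≡ b ∸ q₃
    d≡b∸q₃ = cong (_∸ q₃) (ℕ.m+[n∸m]≡n (ℕ.≤-trans (ℕ.>-nonZero⁻¹ q₃) q₃≤b))
    q₃+d≡b : q₃ + d ≡ b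
    q₃+d≡b = trans (cong (_+_ q₃) d≡b∸q₃) (ℕ.m+[n∸m]≡n q₃≤b)
    q₁+d≡q₂ : q₁ + d ≡ q₂
    q₁+d≡q₂ = trans (cong (_+_ q₁) (trans d≡b∸q₃ (trans (cong (_∸ q₃) b≡q₃+[q₂∸q₁]) (ℕ.m+n∸m≡n q₃ _)))) (ℕ.m+[n∸m]≡n (ℕ.<⇒≤ q₁<q₂))
    b≤1+N : b ≤ suc N
    b≤1+N = ℕ.≤-pred (ℕ.≤-trans (ℕ.m<m+n b 0<q₁) (ℕ.≤-reflexive (trans (ℕ.m∸n+n≡m q₁≤q₃+q₂) (sym 2+N≡))))
    b+e≡1+N : b + e ≡ suc N
    b+e≡1+N = ℕ.m+[n∸m]≡n b≤1+N
    1+e≡q₁ : suc e ≡ q₁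
    1+e≡q₁ = ℕ.+-cancelˡ-≡ b (suc e) q₁ (trans (ℕ.+-suc b e) (trans (cong suc b+e≡1+N) (trans 2+N≡ (sym (ℕ.m∸n+n≡m q₁≤q₃+q₂)))))
    c≤N : c ≤ N
    c≤N = ℕ.≤-pred (ℕ.≤-trans (ℕ.≤-trans (ℕ.≤-reflexive 1+c≡q₃) q₃≤b) b≤1+N)
    -- The exponent in the bound on q: N is the largest exponent in the forms pⁱ x₁ + x₂, and q₁ + 1
    -- the largest in x₁ + pʲ x₂.
    N+1+q₁≡ : N + suc q₁ ≡ q₃ + q₂ + q₁ ∸ 1
    N+1+q₁≡ = trans (ℕ.+-suc N q₁) (cong (λ s → s + q₁ ∸ 1) 2+N≡)

    -- A pair divisible by q is first made primitive; the extracted power s = qᵏ reappears as s³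
    -- inside w, where it is harmless.
    g-sharedVal : ∀ {q} → Prime q → p ^ (q₃ + q₂ + q₁ ∸ 1) < q → ∀ x y w → G x y ℤ.* w ℤ.^ Q ≢ 0ℤ →
      ∃ λ v → SharedVal q₁ q₂ q₃ v × HasVal q v (G x y ℤ.* w ℤ.^ Q)
    g-sharedVal {q} pq p^<q x y w h≢0 = from-split (split₂ pq x y x≢0)
      where
      x≢0 : x ≢ 0ℤ
      -- x is itself a factor of the first block, so a nonzero value forces x to be nonzero, as the
      -- extraction of the common power requires.
      x≢0 = left≢0 (base≢0 (q₁ * q₂) {{ℕ.m*n≢0 q₁ q₂}} (left≢0 (left≢0 (left≢0 h≢0))))
      Goal : ℤ → Set
      Goal h = ∃ λ v → SharedVal q₁ q₂ q₃ v × HasVal q v h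
      scaled : ∀ s u v → G (s ℤ.* u) (s ℤ.* v) ℤ.* w ℤ.^ Q ≡ G u v ℤ.* (s ℤ.* s ℤ.* s ℤ.* w) ℤ.^ Q
      scaled s u v = trans (cong (ℤ._* w ℤ.^ Q) (form-scale p q₃ b 1+c≡q₃ q₁+d≡q₂ 1+e≡q₁ s u v))
        (trans (ℤ.*-assoc (G u v) _ (w ℤ.^ Q)) (cong (ℤ._*_ (G u v)) (sym (^-distrib-* (s ℤ.* s ℤ.* s) w Q))))
      from-split : (∃ λ k → ∃₂ λ u v → x ≡ (+ q) ℤ.^ k ℤ.* u × y ≡ (+ q) ℤ.^ k ℤ.* v × ¬ ((q ∣ ∣ u ∣) × (q ∣ ∣ v ∣))) →
        Goal (G x y ℤ.* w ℤ.^ Q)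
      from-split (k , u , v , x≡ , y≡ , u⊥v) = subst Goal (sym eq)
        (form-sharedVal pp pq q₁ q₂ q₃ c q₃ d b e N (subst (λ M → p ^ M < q) (sym N+1+q₁≡) p^<q)
          c≤N (ℕ.≤-reflexive 1+c≡q₃) (ℕ.≤-reflexive q₃+d≡b) (ℕ.≤-reflexive b+e≡1+N)
          u v (s ℤ.* s ℤ.* s ℤ.* w) u⊥v (subst (_≢ 0ℤ) eq h≢0))
        where
        s = (+ q) ℤ.^ k
        eq : G x y ℤ.* w ℤ.^ Q ≡ G u v ℤ.* (s ℤ.* s ℤ.* s ℤ.* w) ℤ.^ Q
        eq = trans (cong₂ (λ x y → G x y ℤ.* w ℤ.^ Q) x≡ y≡) (scaled s u v)

    -- One argument serves g₂, with W constantly 1, and gₙ, with W = x₃ ⋯ xₙ.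
    not-dense-g : ∀ {n} {h : Polynomial n} (X Y W : Vec ℤ n → ℤ) → (∀ v → ⟦ h ⟧ v ≡ G (X v) (Y v) ℤ.* W v ℤ.^ Q) →
      ∀ q → Prime q → p ^ (q₃ + q₂ + q₁ ∸ 1) < q → ¬ DenseIn q (R h)
    not-dense-g {h = h} X Y W ⟦h⟧ q pq p^<q = not-dense pq {h = h} (SharedVal q₁ q₂ q₃) (sharedVal-gap pq₁ pq₂ pq₃)
      λ v h≢0 → subst (λ z → ∃ λ k → SharedVal q₁ q₂ q₃ k × HasVal q k z) (sym (⟦h⟧ v))
        (g-sharedVal pq p^<q (X v) (Y v) (W v) (subst (_≢ 0ℤ) (⟦h⟧ v) h≢0))

    g-approximation = form-approximation pp pq₁ pq₂ pq₃ q₁<q₂ q₂<q₃ cop c q₃ d b e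

    *1^≡ : ∀ z → z ℤ.* 1ℤ ℤ.^ Q ≡ z
    *1^≡ z = trans (cong (ℤ._*_ z) (ℤ.^-zeroˡ Q)) (ℤ.*-identityʳ z)

    f-sharedVal : ∀ {q} → Prime q → p ^ (q₁ + 1) < q → ∀ v → ⟦ f p q₁ q₂ q₃ ⟧ v ≢ 0ℤ →
      ∃ λ k → SharedVal q₁ q₂ q₃ k × HasVal q k (⟦ f p q₁ q₂ q₃ ⟧ v)
    f-sharedVal {q} pq p^<q (x ∷ []) h≢0 = subst (λ z → ∃ λ k → SharedVal q₁ q₂ q₃ k × HasVal q k z) (sym eq)
      -- With y = 1 the pair is primitive. The lower products are empty, and N = 0 with a = b = 1
      -- makes their ranges consistent and the bound p^(q₁+1).
      (form-sharedVal pp pq q₁ q₂ q₃ 0 1 0 1 0 0 (subst (λ M → p ^ M < q) (ℕ.+-comm q₁ 1) p^<q)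
        z≤n (s≤s z≤n) (s≤s z≤n) (s≤s z≤n) x 1ℤ 1ℤ (λ (_ , q∣1) → ∤1 pq q∣1) (subst (_≢ 0ℤ) eq h≢0))
      where
      eq : ⟦ f p q₁ q₂ q₃ ⟧ (x ∷ []) ≡ form p q₁ q₂ q₃ 0 1 0 1 0 x 1ℤ ℤ.* 1ℤ ℤ.^ Q
      eq = trans (⟦f⟧ p q₁ q₂ q₃ x) (sym (*1^≡ (form p q₁ q₂ q₃ 0 1 0 1 0 x 1ℤ)))

  dense-f : DenseIn p (R (f p q₁ q₂ q₃))
  dense-f = dense {h = f p q₁ q₂ q₃} pp (λ x → form p q₁ q₂ q₃ 0 1 0 1 0 x 1ℤ) (λ x → x ∷ []) (⟦f⟧ p q₁ q₂ q₃)
    (form-approximation pp pq₁ pq₂ pq₃ q₁<q₂ q₂<q₃ cop 0 1 0 1 0)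

  not-dense-f : ∀ q → Prime q → p ^ (q₁ + 1) < q → ¬ DenseIn q (R (f p q₁ q₂ q₃))
  not-dense-f q pq p^<q = not-dense pq {h = f p q₁ q₂ q₃} (SharedVal q₁ q₂ q₃) (sharedVal-gap pq₁ pq₂ pq₃) (f-sharedVal pq p^<q)

  dense-g₂ : DenseIn p (R (g₂ p q₁ q₂ q₃))
  dense-g₂ = dense {h = g₂ p q₁ q₂ q₃} pp (λ x → G x 1ℤ) (λ x → x ∷ 1ℤ ∷ [])
    (λ x → ⟦g₂⟧ p q₁ q₂ q₃ (var zero) (var (suc zero)) (x ∷ 1ℤ ∷ [])) g-approximation

  not-dense-g₂ : ∀ q → Prime q → p ^ (q₃ + q₂ + q₁ ∸ 1) < q → ¬ DenseIn q (R (g₂ p q₁ q₂ q₃))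
  not-dense-g₂ = not-dense-g {h = g₂ p q₁ q₂ q₃} (λ v → lookup v zero) (λ v → lookup v (suc zero)) (λ _ → 1ℤ)
    λ v → trans (⟦g₂⟧ p q₁ q₂ q₃ (var zero) (var (suc zero)) v) (sym (*1^≡ _))

  dense-g : ∀ n n>2 → DenseIn p (R (g p q₁ q₂ q₃ n n>2))
  dense-g (suc zero) (s≤s ())
  dense-g (suc (suc m)) n>2 = dense {h = g p q₁ q₂ q₃ (suc (suc m)) n>2} pp (λ x → G x 1ℤ) point ⟦g⟧-point g-approximation
    where
    -- With x₃, ..., xₙ set to 1, the values of gₙ include those of g₂ at (x , 1), which are already
    -- enough for density.
    point : ℤ → Vec ℤ (suc (suc m))
    point x = x ∷ 1ℤ ∷ replicate m 1ℤ
    ⟦g⟧-point : ∀ x → ⟦ g p q₁ q₂ q₃ (suc (suc m)) n>2 ⟧ (point x) ≡ G x 1ℤ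
    ⟦g⟧-point x = trans (cong₂ ℤ._*_ (⟦g₂⟧ p q₁ q₂ q₃ (var zero) (var (suc zero)) (point x))
      (trans (⟦:^⟧ (foldr _:*_ (con 1ℤ) (tabulate {n = m} λ j → var (suc (suc j)))) Q (point x))
        (cong (ℤ._^ Q) (⟦∏-vars⟧ m (λ j → suc (suc j)) (point x) λ j → lookup-replicate j 1ℤ))))
      (*1^≡ (G x 1ℤ))

  not-dense-gₙ : ∀ n n>2 q → Prime q → p ^ (q₃ + q₂ + q₁ ∸ 1) < q → ¬ DenseIn q (R (g p q₁ q₂ q₃ n n>2))
  not-dense-gₙ (suc zero) (s≤s ())
  not-dense-gₙ (suc (suc m)) n>2 = not-dense-g {h = g p q₁ q₂ q₃ (suc (suc m)) n>2}
    (λ v → lookup v zero) (λ v → lookup v (suc zero)) ⟦ x₃⋯xₙ ⟧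
    λ v → cong₂ ℤ._*_ (⟦g₂⟧ p q₁ q₂ q₃ (var zero) (var (suc zero)) v) (⟦:^⟧ x₃⋯xₙ Q v)
    where
    x₃⋯xₙ : Polynomial (suc (suc m))
    x₃⋯xₙ = foldr _:*_ (con 1ℤ) (tabulate {n = m} λ j → var (suc (suc j)))

theorem4p8 : ∀ (p q₁ q₂ q₃ : ℕ) → Prime p → Prime q₁ → Prime q₂ → Prime q₃ →
    q₁ < q₂ → q₂ < q₃ → Coprime (q₁ * q₂ * q₃) (p * (p ∸ 1)) →
    ( DenseIn p (R (f p q₁ q₂ q₃))
    × NotDenseForAlmostAllPrimes (R (f p q₁ q₂ q₃))
    × (∀ q → Prime q → p ^ (q₁ + 1) < q → ¬ DenseIn q (R (f p q₁ q₂ q₃))) )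
    ×
    ( DenseIn p (R (g₂ p q₁ q₂ q₃))
    × NotDenseForAlmostAllPrimes (R (g₂ p q₁ q₂ q₃))
    × (∀ q → Prime q → p ^ (q₃ + q₂ + q₁ ∸ 1) < q → ¬ DenseIn q (R (g₂ p q₁ q₂ q₃))) )
    ×
    ( ∀ (n : ℕ) (n>2 : 2 < n) →
    DenseIn p (R (g p q₁ q₂ q₃ n n>2))
    × NotDenseForAlmostAllPrimes (R (g p q₁ q₂ q₃ n n>2))
    × (∀ q → Prime q → p ^ (q₃ + q₂ + q₁ ∸ 1) < q → ¬ DenseIn q (R (g p q₁ q₂ q₃ n n>2))) )
theorem4p8 p q₁ q₂ q₃ pp pq₁ pq₂ pq₃ q₁<q₂ q₂<q₃ cop =
  (dense-f pp pq₁ pq₂ pq₃ q₁<q₂ q₂<q₃ cop , almost-all (p ^ (q₁ + 1)) nf , nf) ,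
  (dense-g₂ pp pq₁ pq₂ pq₃ q₁<q₂ q₂<q₃ cop , almost-all bound ng₂ , ng₂) ,
  λ n n>2 → dense-g pp pq₁ pq₂ pq₃ q₁<q₂ q₂<q₃ cop n n>2 , almost-all bound (ng n n>2) , ng n n>2
  where
  bound = p ^ (q₃ + q₂ + q₁ ∸ 1)
  nf = not-dense-f pp pq₁ pq₂ pq₃ q₁<q₂ q₂<q₃ cop
  ng₂ = not-dense-g₂ pp pq₁ pq₂ pq₃ q₁<q₂ q₂<q₃ cop
  ng = not-dense-gₙ pp pq₁ pq₂ pq₃ q₁<q₂ q₂<q₃ cop
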